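{- Let $H$ be a connected hypergraph, $p\ge1$, and $f\in\mathcal V_p(H)$ with $f_1(v)+\cdots+f_p(v)\ge d_H(v)$ for all $v\in V(H)$, such that $H$ is not $f$-partitionable. Then $H$ is $f$-hard.
   Context: A hypergraph $H=(V,E,i)$ consists of finite sets $V(H)$, $E(H)$ and an incidence function $i_H:E\to 2^V$ with $|i(e)|\ge 2$ (parallel edges allowed; edges with $|i(e)|=2$ are ordinary). $H[X]$ is the subhypergraph with vertex set $X$ and edges $e$ with $i_H(e)\subseteq X$ (induced subhypergraph). The degree $d_H(v)$ is the number of edges incident with $v$. $H$ is connected if nonempty and for every $\emptyset\ne X\subsetneq V(H)$ some edge meets both $X$ and its complement. A vertex $v$ is separating if $H$ is the union of two induced subhypergraphs $H_1,H_2$ with $V(H_1)\cap V(H_2)=\{v\}$, $|V(H_i)|\ge2$; a block is a maximal connected subhypergraph without separating vertex. For $h:V(H)\to\mathbb N_0$, $H$ is strictly $h$-degenerate if every nonempty subhypergraph $G$ has a vertex $v$ with $d_G(v)<h(v)$. $\mathcal V_p(H)$ is the set of $f=(f_1,\dots,f_p):V(H)\to\mathbb N_0^p$. An $f$-partition is a sequence $(H_1,\dots,H_p)$ of pairwise vertex-disjoint, possibly empty, induced subhypergraphs covering $V(H)$ with each $H_i$ strictly $f_i$-degenerate; $H$ is $f$-partitionable if one exists. $tK_n$: $n$ vertices, each pair joined by exactly $t$ parallel ordinary edges, no other edges; $tC_n$ ($n\ge3$): cycle of length $n$ with each edge replaced by $t$ parallel ordinary edges. Merging disjoint $H^1,H^2$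 at $v^1\in V(H^1),v^2\in V(H^2)$: identify $v^1,v^2$ to a new vertex $v^*$, keeping all edges. $(H,f)$ with $H$ connected is a hard pair ($H$ is $f$-hard) if: (M) $H$ is a block and for some $j$, $f_j(v)=d_H(v)$ and $f_i(v)=0$ for $i\ne j$, all $v$; or (K) $H=tK_n$, $t\ge1,n\ge3$, and $f(v)=(tn_1,\dots,tn_p)$ for all $v$, with integers $n_i\ge0$, at least two nonzero, $\sum n_i=n-1$; or (C) $H=tC_n$, $t\ge1$, $n\ge5$ odd, and for some $k\ne\ell$, $f_k\equiv f_\ell\equiv t$ and all other coordinates $\equiv0$; or (merge) $(H,f)$ arises from hard pairs $(H^1,f^1),(H^2,f^2)$ by merging $v^1,v^2$ to $v^*$ with $f=f^j$ on $V(H^j)\setminus\{v^j\}$ and $f(v^*)=f^1(v^1)+f^2(v^2)$. -}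

module Defs where

open import Data.Nat using (ℕ; zero; suc; _+_; _*_; _∸_; _≤_; _<_)
open import Data.Fin using (Fin; zero; suc; toℕ; _≟_)
open import Data.Bool using (Bool; true; false; _∧_; if_then_else_)
open import Data.Sum using (_⊎_; inj₁; inj₂)
open import Data.Product using (Σ; ∃; ∃-syntax; _×_; _,_)
open import Relation.Nullary using (¬_; does)
open import Relation.Binary.PropositionalEquality using (_≡_; _≢_)
open import Function.Bundles using (_↔_; Inverse)
open import Function.Definitions using (Injective)

sumFin : {n : ℕ} → (Fin n → ℕ) → ℕ
sumFin {zero}  g = 0
sumFin {suc n} g = g zero + sumFin (λ i → g (suc i))

count : {n : ℕ} → (Fin n → Bool) → ℕ
count b = sumFin (λ i → if b i then 1 else 0)

-- Hypergraphs: V(H) = Fin nv, E(H) = Fin ne, incidence i_H(e) as a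
-- characteristic function on the vertices, |i_H(e)| ≥ 2.

record Hypergraph : Set where
  field
    nv  : ℕ
    ne  : ℕ
    inc : Fin ne → Fin nv → Bool
    inc-≥2 : ∀ e → 2 ≤ count (inc e)
open Hypergraph public

VSet : Hypergraph → Set
VSet H = Fin (nv H) → Bool

deg : (H : Hypergraph) → Fin (nv H) → ℕ
deg H v = count (λ e → inc H e v)

Ordinary : (H : Hypergraph) → Fin (ne H) → Set
Ordinary H e = count (inc H e) ≡ 2

mult : (H : Hypergraph) → Fin (nv H) → Fin (nv H) → ℕ
mult H u w = count (λ e → inc H e u ∧ inc H e w)

Connected : Hypergraph → Set
Connected H =
  (1 ≤ nv H) ×
  ((X : VSet H) → (∃[ v ] X v ≡ true) → (∃[ v ] X v ≡ false) →
    ∃[ e ] ∃[ u ] ∃[ w ]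
      (inc H e u ≡ true × X u ≡ true × inc H e w ≡ true × X w ≡ false))

EdgeIn : (H : Hypergraph) → VSet H → Fin (ne H) → Set
EdgeIn H X e = ∀ u → inc H e u ≡ true → X u ≡ true

Separating : (H : Hypergraph) → Fin (nv H) → Set
Separating H v =
  ∃[ X₁ ] ∃[ X₂ ]
    ((∀ u → (X₁ u ≡ true) ⊎ (X₂ u ≡ true)) ×
     (∀ u → (X₁ u ≡ true × X₂ u ≡ true) → u ≡ v) ×
     (X₁ v ≡ true) × (X₂ v ≡ true) ×
     (2 ≤ count X₁) × (2 ≤ count X₂) ×
     (∀ e → EdgeIn H X₁ e ⊎ EdgeIn H X₂ e))

IsBlock : Hypergraph → Set
IsBlock H = Connected H × ¬ (∃[ v ] Separating H v)

-- a subhypergraph G of H is given by (X, F): vertex set X, edge set F,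
-- with every edge of F having all its vertices in X.
-- degree of v in the subhypergraph with edge set F:
degSub : (H : Hypergraph) → (Fin (ne H) → Bool) → Fin (nv H) → ℕ
degSub H F v = count (λ e → F e ∧ inc H e v)

-- the induced subhypergraph H[Y] is strictly h-degenerate
-- (subhypergraphs of H[Y] = subhypergraphs of H with vertex set ⊆ Y)
StrictlyDegenerate : (H : Hypergraph) → VSet H → (Fin (nv H) → ℕ) → Set
StrictlyDegenerate H Y h =
  (X : VSet H) (F : Fin (ne H) → Bool) →
  (∀ v → X v ≡ true → Y v ≡ true) →
  (∀ e → F e ≡ true → EdgeIn H X e) →
  (∃[ v ] X v ≡ true) →
  ∃[ v ] (X v ≡ true × degSub H F v < h v)

VFun : ℕ → Hypergraph → Set
VFun p H = Fin (nv H) → Fin p → ℕ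

-- an f-partition (H₁,…,H_p) is given by the map sending each vertex to
-- the index of the part containing it; H_i = H[{v | c v = i}].
Partitionable : {p : ℕ} (H : Hypergraph) → VFun p H → Set
Partitionable {p} H f =
  Σ (Fin (nv H) → Fin p) λ c → ((i : Fin p) →
    StrictlyDegenerate H (λ v → does (c v ≟ i)) (λ v → f v i))

CycAdj : {n : ℕ} → Fin n → Fin n → Set
CycAdj {n} i j =
  (suc (toℕ i) ≡ toℕ j) ⊎ (suc (toℕ j) ≡ toℕ i) ⊎
  (toℕ i ≡ 0 × suc (toℕ j) ≡ n) ⊎ (toℕ j ≡ 0 × suc (toℕ i) ≡ n)

data Hard {p : ℕ} : (H : Hypergraph) → VFun p H → Set where
  hardM : (H : Hypergraph) (f : VFun p H) (j : Fin p) →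
    IsBlock H →
    (∀ v → f v j ≡ deg H v) →
    (∀ v i → i ≢ j → f v i ≡ 0) →
    Hard H f
  -- (K): H = tK_n (up to relabelling of vertices/edges)
  hardK : (H : Hypergraph) (f : VFun p H) (t n : ℕ) →
    1 ≤ t → 3 ≤ n → nv H ≡ n →
    (∀ e → Ordinary H e) →
    (∀ u w → u ≢ w → mult H u w ≡ t) →
    (ns : Fin p → ℕ) →
    (∃[ i ] ∃[ j ] (i ≢ j × ns i ≢ 0 × ns j ≢ 0)) →
    sumFin ns ≡ n ∸ 1 →
    (∀ v i → f v i ≡ t * ns i) →
    Hard H f
  -- (C): H = tC_n, n ≥ 5 odd; σ places the vertices around the cycle
  hardC : (H : Hypergraph) (f : VFun p H) (t k : ℕ) →
    1 ≤ t → 5 ≤ nv H → nv H ≡ suc (2 * k) →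
    (σ : Fin (nv H) ↔ Fin (nv H)) →
    (∀ e → Ordinary H e) →
    (∀ u w → u ≢ w → CycAdj (Inverse.to σ u) (Inverse.to σ w) → mult H u w ≡ t) →
    (∀ u w → u ≢ w → ¬ CycAdj (Inverse.to σ u) (Inverse.to σ w) → mult H u w ≡ 0) →
    (a b : Fin p) → a ≢ b →
    (∀ v → f v a ≡ t) → (∀ v → f v b ≡ t) →
    (∀ v i → i ≢ a → i ≢ b → f v i ≡ 0) →
    Hard H f
  -- (merge): H is (isomorphic to) the merge of H¹ at v¹ and H² at v²;
  -- ι₁, ι₂ embed the vertex sets, ψ identifies the edge sets.
  hardMerge : (H : Hypergraph) (f : VFun p H)
    (H¹ : Hypergraph) (f¹ : VFun p H¹) (H² : Hypergraph) (f² : VFun p H²) →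
    Hard H¹ f¹ → Hard H² f² →
    (v¹ : Fin (nv H¹)) (v² : Fin (nv H²)) →
    (ι₁ : Fin (nv H¹) → Fin (nv H)) (ι₂ : Fin (nv H²) → Fin (nv H)) →
    Injective _≡_ _≡_ ι₁ → Injective _≡_ _≡_ ι₂ →
    (∀ v → (∃[ u ] ι₁ u ≡ v) ⊎ (∃[ u ] ι₂ u ≡ v)) →
    ι₁ v¹ ≡ ι₂ v² →
    (∀ u₁ u₂ → ι₁ u₁ ≡ ι₂ u₂ → u₁ ≡ v¹) →
    (ψ : Fin (ne H) ↔ (Fin (ne H¹) ⊎ Fin (ne H²))) →
    (∀ e₁ u → inc H (Inverse.from ψ (inj₁ e₁)) (ι₁ u) ≡ inc H¹ e₁ u) →
    (∀ e₁ v → inc H (Inverse.from ψ (inj₁ e₁)) v ≡ true → ∃[ u ] ι₁ u ≡ v) →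
    (∀ e₂ u → inc H (Inverse.from ψ (inj₂ e₂)) (ι₂ u) ≡ inc H² e₂ u) →
    (∀ e₂ v → inc H (Inverse.from ψ (inj₂ e₂)) v ≡ true → ∃[ u ] ι₂ u ≡ v) →
    (∀ u i → u ≢ v¹ → f (ι₁ u) i ≡ f¹ u i) →
    (∀ u i → u ≢ v² → f (ι₂ u) i ≡ f² u i) →
    (∀ i → f (ι₁ v¹) i ≡ f¹ v¹ i + f² v² i) →
    Hard H f

{-# OPTIONS --safe #-}
module Submission where

-- Colour the vertices one by one towards a last vertex z (the hole): since Σ f ≥ d, every H − z has an f-partition, and
-- since H has none, every edge at z is monochromatic off z and exactly f_i(z) of these edges have colour i.  Moving the
-- hole to a neighbour u, and the colour of u to z, gives a partition of H − u of the same kind, as in the 15-puzzle.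
-- If v is separating, the colours at the hole v split f(v) between the two sides, and induction applies to both.
-- Otherwise the hole can go anywhere while avoiding any given vertex.  If some state is monochromatic, all are, which is
-- case (M).  If not, no set T of at least three vertices can be rigid, that is, monochromatic off the hole whenever the
-- hole is in T: the colour of T would spread to all vertices.  Hyperedges with three vertices, triangles with unequal
-- multiplicities and 4-cycles with a missing diagonal are rigid, the latter by comparing f before and after the hole has
-- gone once round.  If any two vertices are adjacent, this gives (K).  Otherwise there is a chordless cycle of length at
-- least 5, on which the colours seen from the hole have period 2; it would be rigid if it had a neighbour outside, so it
-- is all of H, and its length is odd because the colours are not constant: (C).

open import Defs
open import Data.Nat using (ℕ; zero; suc; _+_; _*_; _∸_; _≤_; _<_; z≤n; s≤s)
open import Data.Nat.Properties renaming (_≟_ to _≟ℕ_)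
open import Algebra.Properties.CommutativeSemigroup +-commutativeSemigroup using (interchange)
open import Data.Fin using (Fin; zero; suc; toℕ; fromℕ<; _≟_)
open import Data.Fin.Properties using (any?; all?; injective⇒≤; toℕ-fromℕ<; toℕ-injective; toℕ<n) renaming (suc-injective to Fin-suc-injective)
open import Data.Bool using (Bool; true; false; _∧_; not; if_then_else_) renaming (_≟_ to _≟ᵇ_)
open import Data.Bool.Properties using (∧-comm)
open import Data.Sum using (_⊎_; inj₁; inj₂; [_,_]′)
open import Data.Product using (∃; ∃-syntax; _×_; _,_; proj₁; proj₂)
open import Data.Empty using (⊥; ⊥-elim)
open import Data.Unit using (⊤; tt)
open import Data.List using (List; []; _∷_; length)
open import Data.List.Relation.Unary.All using (All; []; _∷_)
open import Relation.Nullary using (¬_; Dec; yes; no; does; contradiction)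
open import Relation.Nullary.Decidable using (dec-true; dec-false; decidable-stable; _×-dec_; _→-dec_; ¬?; _⊎-dec_)
open import Relation.Binary.Definitions using (tri<; tri≈; tri>)
open import Relation.Binary.PropositionalEquality
open import Relation.Binary.Construct.Closure.ReflexiveTransitive using (Star; ε; _◅_; _◅◅_)
open import Function using (_∘_; id)
open import Function.Bundles using (_↔_; Inverse; mk↔ₛ′)

private
  variable
    n k : ℕ

-- Finite sums and counting

ind : Bool → ℕ
ind b = if b then 1 else 0

sum-cong : {g h : Fin n → ℕ} → (∀ i → g i ≡ h i) → sumFin g ≡ sumFin h
sum-cong {zero}  eq = refl
sum-cong {suc n} eq = cong₂ _+_ (eq zero) (sum-cong (λ i → eq (suc i)))

sum-mono : {g h : Fin n → ℕ} → (∀ i → g i ≤ h i) → sumFin g ≤ sumFin h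
sum-mono {zero}  le = z≤n
sum-mono {suc n} le = +-mono-≤ (le zero) (sum-mono (λ i → le (suc i)))

sum-mono-< : {g h : Fin n → ℕ} → (∀ i → g i ≤ h i) → ∀ j → g j < h j → sumFin g < sumFin h
sum-mono-< le zero    lt = +-mono-<-≤ lt (sum-mono (λ i → le (suc i)))
sum-mono-< le (suc j) lt = +-mono-≤-< (le zero) (sum-mono-< (λ i → le (suc i)) j lt)

-- A strict inequality at one index would make the sums strictly ordered. The equalities between `f`
-- and edge counts in `Tight` come from here.
sum-squeeze : {g h : Fin n → ℕ} → (∀ i → g i ≤ h i) → sumFin h ≤ sumFin g → ∀ i → g i ≡ h i
sum-squeeze le ge i with m≤n⇒m<n∨m≡n (le i)
... | inj₂ eq = eq
... | inj₁ lt = contradiction ge (<⇒≱ (sum-mono-< le i lt))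

sum-+ : (g h : Fin n → ℕ) → sumFin (λ i → g i + h i) ≡ sumFin g + sumFin h
sum-+ {zero}  g h = refl
sum-+ {suc n} g h rewrite sum-+ (λ i → g (suc i)) (λ i → h (suc i)) =
  interchange (g zero) (h zero) (sumFin (λ i → g (suc i))) (sumFin (λ i → h (suc i)))

sum-0 : sumFin {n} (λ _ → 0) ≡ 0
sum-0 {zero}  = refl
sum-0 {suc n} = sum-0 {n}

sum-1 : sumFin {n} (λ _ → 1) ≡ n
sum-1 {zero}  = refl
sum-1 {suc n} = cong suc sum-1

sum-swap : (g : Fin n → Fin k → ℕ) →
  sumFin (λ i → sumFin (g i)) ≡ sumFin (λ j → sumFin (λ i → g i j))
sum-swap {zero}  {k} g = sym (sum-0 {k})
sum-swap {suc n} g = trans (cong (sumFin (g zero) +_) (sum-swap (λ i → g (suc i))))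
  (sym (sum-+ (g zero) (λ j → sumFin (λ i → g (suc i) j))))

sum-*ˡ : ∀ t (g : Fin n → ℕ) → sumFin (λ i → t * g i) ≡ t * sumFin g
sum-*ˡ {zero}  t g = sym (*-zeroʳ t)
sum-*ˡ {suc n} t g = trans (cong (t * g zero +_) (sum-*ˡ t (λ i → g (suc i))))
  (sym (*-distribˡ-+ t (g zero) _))

sum-at : (g h : Fin n → ℕ) (a : Fin n) → (∀ i → i ≢ a → g i ≡ h i) →
  sumFin g + h a ≡ sumFin h + g a
sum-at g h zero eq
  rewrite sum-cong {g = λ i → g (suc i)} {h = λ i → h (suc i)} (λ i → eq (suc i) (λ ())) =
  trans (+-comm _ (h zero)) (trans (cong (h zero +_) (+-comm (g zero) _)) (sym (+-assoc (h zero) _ _)))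
sum-at g h (suc a) eq rewrite eq zero (λ ()) =
  trans (+-assoc (h zero) _ _) (trans (cong (h zero +_)
    (sum-at (λ i → g (suc i)) (λ i → h (suc i)) a (λ i i≢a → eq (suc i) (λ e → i≢a (Fin-suc-injective e)))))
    (sym (+-assoc (h zero) _ _)))

sum-at₂ : (g h : Fin n → ℕ) (a b : Fin n) → a ≢ b → (∀ i → i ≢ a → i ≢ b → g i ≡ h i) →
  sumFin g + (h a + h b) ≡ sumFin h + (g a + g b)
sum-at₂ g h a b a≢b eq = begin
  sumFin g + (h a + h b)   ≡⟨ cong (λ x → sumFin g + (x + h b)) (sym la) ⟩
  sumFin g + (l a + h b)   ≡⟨ sym (+-assoc (sumFin g) (l a) (h b)) ⟩
  sumFin g + l a + h b     ≡⟨ cong (_+ h b) (sum-at g l a g≡l) ⟩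
  sumFin l + g a + h b     ≡⟨ +-assoc (sumFin l) (g a) (h b) ⟩
  sumFin l + (g a + h b)   ≡⟨ cong (sumFin l +_) (+-comm (g a) (h b)) ⟩
  sumFin l + (h b + g a)   ≡⟨ sym (+-assoc (sumFin l) (h b) (g a)) ⟩
  sumFin l + h b + g a     ≡⟨ cong (_+ g a) (sum-at l h b l≡h) ⟩
  sumFin h + l b + g a     ≡⟨ cong (λ x → sumFin h + x + g a) lb ⟩
  sumFin h + g b + g a     ≡⟨ +-assoc (sumFin h) (g b) (g a) ⟩
  sumFin h + (g b + g a)   ≡⟨ cong (sumFin h +_) (+-comm (g b) (g a)) ⟩
  sumFin h + (g a + g b)   ∎
  where
  open ≡-Reasoning
  -- Intermediate function: `h` at `a` and `g` elsewhere, so that `g`, `l` and likewise `l`, `h`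
  -- differ in one place only.
  l : Fin _ → ℕ
  l i = if does (i ≟ a) then h a else g i
  la : l a ≡ h a
  la rewrite dec-true (a ≟ a) refl = refl
  lb : l b ≡ g b
  lb rewrite dec-false (b ≟ a) (a≢b ∘ sym) = refl
  g≡l : ∀ i → i ≢ a → g i ≡ l i
  g≡l i i≢a rewrite dec-false (i ≟ a) i≢a = refl
  l≡h : ∀ i → i ≢ b → l i ≡ h i
  l≡h i i≢b with i ≟ a
  ... | yes refl = refl
  ... | no i≢a = eq i i≢a i≢b

sum-single : (g : Fin n → ℕ) (a : Fin n) → (∀ i → i ≢ a → g i ≡ 0) → sumFin g ≡ g a
sum-single {n} g a eq = trans (sym (+-identityʳ _)) (trans (sum-at g (λ _ → 0) a eq) (cong (_+ g a) (sum-0 {n})))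

sum-double : (g : Fin n → ℕ) (a b : Fin n) → a ≢ b → (∀ i → i ≢ a → i ≢ b → g i ≡ 0) →
  sumFin g ≡ g a + g b
sum-double {n} g a b a≢b eq =
  trans (sym (+-identityʳ _)) (trans (sum-at₂ g (λ _ → 0) a b a≢b eq) (cong (_+ (g a + g b)) (sum-0 {n})))

does⇒ : {A : Set} (d : Dec A) → does d ≡ true → A
does⇒ (yes a) _ = a

does⇒¬ : {A : Set} (d : Dec A) → does d ≡ false → ¬ A
does⇒¬ (no ¬a) _ = ¬a

not-true : ∀ {b} → ¬ (b ≡ true) → b ≡ false
not-true {false} _ = refl
not-true {true}  h = ⊥-elim (h refl)

true≢false : ∀ {b} → b ≡ true → b ≡ false → ⊥
true≢false refl ()

∧-true : ∀ {a b} → a ≡ true → b ≡ true → a ∧ b ≡ true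
∧-true refl refl = refl

∧-trueˡ : ∀ {a b} → a ∧ b ≡ true → a ≡ true
∧-trueˡ {true} _ = refl

∧-trueʳ : ∀ {a b} → a ∧ b ≡ true → b ≡ true
∧-trueʳ {true} e = e

bool-ext : ∀ {a b} → (a ≡ true → b ≡ true) → (b ≡ true → a ≡ true) → a ≡ b
bool-ext {true}  {b}     f g = sym (f refl)
bool-ext {false} {false} f g = refl
bool-ext {false} {true}  f g = g refl

ind-mono : ∀ {a b} → (a ≡ true → b ≡ true) → ind a ≤ ind b
ind-mono {false} h = z≤n
ind-mono {true}  h rewrite h refl = ≤-refl

ind-true : ∀ {b} → b ≡ true → ind b ≡ 1
ind-true refl = refl

ind-false : ∀ {b} → ¬ (b ≡ true) → ind b ≡ 0
ind-false h rewrite not-true h = refl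

count-mono : {b d : Fin n → Bool} → (∀ i → b i ≡ true → d i ≡ true) → count b ≤ count d
count-mono h = sum-mono (λ i → ind-mono (h i))

count-mono-< : {b d : Fin n → Bool} → (∀ i → b i ≡ true → d i ≡ true) →
  ∀ j → b j ≡ false → d j ≡ true → count b < count d
count-mono-< {b = b} {d} h j bj dj = sum-mono-< (λ i → ind-mono (h i)) j lt
  where
  lt : ind (b j) < ind (d j)
  lt rewrite bj | dj = s≤s z≤n

count-cong : {b d : Fin n → Bool} → (∀ i → b i ≡ d i) → count b ≡ count d
count-cong h = sum-cong (λ i → cong ind (h i))

_∖_ : (Fin n → Bool) → Fin n → Fin n → Bool
(b ∖ z) u = b u ∧ not (does (u ≟ z))

∖-intro : ∀ (b : Fin n → Bool) {z u} → b u ≡ true → u ≢ z → (b ∖ z) u ≡ true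
∖-intro b {z} {u} bu u≢z rewrite bu | dec-false (u ≟ z) u≢z = refl

∖-elim : ∀ (b : Fin n → Bool) {z u} → (b ∖ z) u ≡ true → b u ≡ true × u ≢ z
∖-elim b {z} {u} h = ∧-trueˡ {b u} h , neq
  where
  neq : u ≢ z
  neq refl = contradiction (trans (sym (cong not (dec-true (z ≟ z) refl))) (∧-trueʳ {b z} h)) (λ ())

count-∖ : (b : Fin n → Bool) (z : Fin n) → count b ≡ count (b ∖ z) + ind (b z)
count-∖ b z = trans (sym (+-identityʳ _)) (trans (cong (count b +_) (sym at-z)) (sum-at _ _ z off-z))
  where
  at-z : ind ((b ∖ z) z) ≡ 0
  at-z = ind-false {(b ∖ z) z} (λ h → proj₂ (∖-elim b h) refl)
  off-z : ∀ i → i ≢ z → ind (b i) ≡ ind ((b ∖ z) i)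
  off-z i i≢z rewrite dec-false (i ≟ z) i≢z with b i
  ... | true = refl
  ... | false = refl

count-pos⇒ : (b : Fin n → Bool) → 1 ≤ count b → ∃[ u ] b u ≡ true
count-pos⇒ {n} b h with any? (λ u → b u ≟ᵇ true)
... | yes p = p
... | no ¬p = contradiction h (<⇒≱ (s≤s (≤-reflexive (trans (sum-cong z) (sum-0 {n})))))
  where
  z : ∀ i → ind (b i) ≡ 0
  z i = ind-false (λ e → ¬p (i , e))

count-pos : (b : Fin n → Bool) → ∀ u → b u ≡ true → 1 ≤ count b
count-pos b u bu = ≤-trans (m≤n+m 1 _) (≤-reflexive (sym (trans (count-∖ b u) (cong (count (b ∖ u) +_) (ind-true bu)))))

ind≤1 : ∀ b → ind b ≤ 1
ind≤1 true  = ≤-refl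
ind≤1 false = z≤n

count-∖-≥ : (b : Fin n → Bool) (z : Fin n) → suc k ≤ count b → k ≤ count (b ∖ z)
count-∖-≥ {k = k} b z h = +-cancelʳ-≤ 1 k _
  (≤-trans (≤-reflexive (+-comm k 1)) (≤-trans (≤-trans h (≤-reflexive (count-∖ b z))) (+-monoʳ-≤ _ (ind≤1 (b z)))))

count≥2⇒ : (b : Fin n → Bool) → 2 ≤ count b → ∀ z → ∃[ u ] (b u ≡ true × u ≢ z)
count≥2⇒ b h z with count-pos⇒ (b ∖ z) (count-∖-≥ b z h)
... | u , e = u , ∖-elim b e

count≥3⇒ : (b : Fin n → Bool) → 3 ≤ count b → ∀ y z → ∃[ u ] (b u ≡ true × u ≢ y × u ≢ z)
count≥3⇒ b h y z with count≥2⇒ (b ∖ z) (count-∖-≥ b z h) y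
... | u , e , u≢y = u , proj₁ (∖-elim b e) , u≢y , proj₂ (∖-elim b e)

count≥2 : (b : Fin n → Bool) → ∀ u w → b u ≡ true → b w ≡ true → u ≢ w → 2 ≤ count b
count≥2 b u w bu bw u≢w = ≤-trans (+-monoˡ-≤ 1 (count-pos (b ∖ w) u (∖-intro b bu u≢w)))
  (≤-reflexive (sym (trans (count-∖ b w) (cong (count (b ∖ w) +_) (ind-true bw)))))

count≥3 : (b : Fin n → Bool) → ∀ u w x → b u ≡ true → b w ≡ true → b x ≡ true →
  u ≢ w → u ≢ x → w ≢ x → 3 ≤ count b
count≥3 b u w x bu bw bx u≢w u≢x w≢x =
  ≤-trans (+-monoˡ-≤ 1 (count≥2 (b ∖ x) u w (∖-intro b bu u≢x) (∖-intro b bw w≢x) u≢w))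
  (≤-reflexive (sym (trans (count-∖ b x) (cong (count (b ∖ x) +_) (ind-true bx)))))

-- At most one of the sets contains `e`, so the count is 0 or 1. Summed over `e`, this bounds the
-- number of monochromatic edges at a vertex, over all colours, by the size of `D`.
sum-count-disjoint : (B : Fin k → Fin n → Bool) (D : Fin n → Bool) →
  (∀ i e → B i e ≡ true → D e ≡ true) → (∀ i j e → B i e ≡ true → B j e ≡ true → i ≡ j) →
  ∀ e → count (λ i → B i e) ≤ ind (D e)
sum-count-disjoint {k = k} B D sub disj e with any? (λ i → B i e ≟ᵇ true)
... | yes (i , p) = ≤-reflexive (trans (sum-single _ i (λ j j≢i → ind-false (λ q → j≢i (disj j i e q p))))
    (trans (ind-true p) (sym (ind-true (sub i e p)))))
... | no ¬p = ≤-trans (≤-reflexive (trans (sum-cong (λ i → ind-false (λ q → ¬p (i , q)))) (sum-0 {k}))) z≤n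

-- Turns a subset into a `Fin` of its own, which is how the sides of a separating vertex become
-- hypergraphs; `sum-elem` carries degrees across.
record Listing (b : Fin n → Bool) : Set where
  field
    size   : ℕ
    elem   : Fin size → Fin n
    inj    : ∀ {i j} → elem i ≡ elem j → i ≡ j
    sound  : ∀ i → b (elem i) ≡ true
    index  : ∀ v → b v ≡ true → Fin size
    elem-index : ∀ v (p : b v ≡ true) → elem (index v p) ≡ v
    sum-elem : (g : Fin n → ℕ) → sumFin (λ i → g (elem i)) ≡ sumFin (λ v → if b v then g v else 0)
open Listing public

listing : (b : Fin n → Bool) → Listing b
listing {zero} b = record { size = 0 ; elem = λ () ; inj = λ { {()} } ; sound = λ () ; index = λ ()
  ; elem-index = λ () ; sum-elem = λ g → refl }
listing {suc n} b with listing (λ i → b (suc i)) | b zero in eq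
... | L | true = record
  { size = suc (size L) ; elem = el ; inj = inj′ _ _ ; sound = snd ; index = ix
  ; elem-index = eix
  ; sum-elem = λ g → cong₂ _+_ (cong (if_then g zero else 0) (sym eq)) (sum-elem L (λ i → g (suc i))) }
  where
  el : Fin (suc (size L)) → Fin (suc n)
  el zero    = zero
  el (suc i) = suc (elem L i)
  inj′ : ∀ i j → el i ≡ el j → i ≡ j
  inj′ zero    zero    _ = refl
  inj′ (suc i) (suc j) e = cong suc (inj L (Fin-suc-injective e))
  snd : ∀ i → b (el i) ≡ true
  snd zero    = eq
  snd (suc i) = sound L i
  ix : ∀ v → b v ≡ true → Fin (suc (size L))
  ix zero    p = zero
  ix (suc v) p = suc (index L v p)
  eix : ∀ v (p : b v ≡ true) → el (ix v p) ≡ v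
  eix zero    p = refl
  eix (suc v) p = cong suc (elem-index L v p)
... | L | false = record
  { size = size L ; elem = λ i → suc (elem L i) ; inj = λ e → inj L (Fin-suc-injective e)
  ; sound = sound L ; index = ix ; elem-index = eix
  ; sum-elem = λ g → trans (sum-elem L (λ i → g (suc i)))
      (cong (_+ sumFin (λ v → if b (suc v) then g (suc v) else 0)) (cong (if_then g zero else 0) (sym eq))) }
  where
  ix : ∀ v → b v ≡ true → Fin (size L)
  ix zero    p = ⊥-elim (true≢false p eq)
  ix (suc v) p = index L v p
  eix : ∀ v (p : b v ≡ true) → suc (elem L (ix v p)) ≡ v
  eix zero    p = ⊥-elim (true≢false p eq)
  eix (suc v) p = cong suc (elem-index L v p)

-- Constructive by recursion on the finite index. It turns a dichotomy for each triple of vertices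
-- into a global one.
all-or : {A : Fin n → Set} {B : Set} → (∀ i → A i ⊎ B) → (∀ i → A i) ⊎ B
all-or {zero}  h = inj₁ λ ()
all-or {suc n} h with h zero | all-or (λ i → h (suc i))
... | inj₂ b | _      = inj₂ b
... | inj₁ a | inj₂ b = inj₂ b
... | inj₁ a | inj₁ g = inj₁ λ { zero → a ; (suc i) → g i }


upd : {A : Set} → (Fin n → A) → Fin n → A → Fin n → A
upd c z x u = if does (u ≟ z) then x else c u

upd-at : {A : Set} (c : Fin n → A) (z : Fin n) (x : A) → upd c z x z ≡ x
upd-at c z x rewrite dec-true (z ≟ z) refl = refl

upd-off : {A : Set} (c : Fin n → A) {z u : Fin n} (x : A) → u ≢ z → upd c z x u ≡ c u
upd-off c {z} {u} x u≢z rewrite dec-false (u ≟ z) u≢z = refl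

full : Fin n → Bool
full _ = true

-- Adjacency and edges inside vertex sets

Adj : (H : Hypergraph) → Fin (nv H) → Fin (nv H) → Set
Adj H a b = a ≢ b × ∃[ e ] (inc H e a ≡ true × inc H e b ≡ true)

adj? : ∀ H a b → Dec (Adj H a b)
adj? H a b = ¬? (a ≟ b) ×-dec any? (λ e → (inc H e a ≟ᵇ true) ×-dec (inc H e b ≟ᵇ true))

adj-sym : ∀ H {a b} → Adj H a b → Adj H b a
adj-sym H (a≢b , e , ea , eb) = (λ eq → a≢b (sym eq)) , e , eb , ea

edgeIn? : ∀ H X e → Dec (EdgeIn H X e)
edgeIn? H X e = all? (λ u → (inc H e u ≟ᵇ true) →-dec (X u ≟ᵇ true))

inside : (H : Hypergraph) → VSet H → Fin (ne H) → Bool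
inside H X e = does (edgeIn? H X e)

-- An arbitrary vertex of `e` different from `z`. In the tight states below, an edge at the hole `z`
-- is monochromatic off `z`, so this one vertex shows the colour of the edge.
other : (H : Hypergraph) → Fin (nv H) → Fin (ne H) → Fin (nv H)
other H z e = proj₁ (count≥2⇒ (inc H e) (inc-≥2 H e) z)

other-∈ : ∀ H z e → inc H e (other H z e) ≡ true
other-∈ H z e = proj₁ (proj₂ (count≥2⇒ (inc H e) (inc-≥2 H e) z))

other-≢ : ∀ H z e → other H z e ≢ z
other-≢ H z e = proj₂ (proj₂ (count≥2⇒ (inc H e) (inc-≥2 H e) z))

sum-colour : ∀ {p} (x : Fin p) → sumFin (λ i → ind (does (x ≟ i))) ≡ 1
sum-colour x = trans (sum-single _ x (λ i i≢x → ind-false (λ h → i≢x (sym (does⇒ (x ≟ i) h)))))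
  (ind-true (dec-true (x ≟ x) refl))

-- Partial colourings, states and moves of the hole

module Colouring (H : Hypergraph) {p : ℕ} (f : VFun p H) where

  private
    V = Fin (nv H)

  -- Among the subhypergraphs on a given vertex set the induced one has the largest degrees, so only those are tested.
  Good : VSet H → (V → Fin p) → Set
  Good Y c = (X : VSet H) (i : Fin p) → (∀ v → X v ≡ true → Y v ≡ true) → (∀ v → X v ≡ true → c v ≡ i) →
    (∃[ v ] X v ≡ true) → ∃[ v ] (X v ≡ true × degSub H (inside H X) v < f v i)

  good-⊆ : ∀ {Y Y′ c} → (∀ v → Y′ v ≡ true → Y v ≡ true) → Good Y c → Good Y′ c
  good-⊆ sub g X i X⊆Y′ = g X i (λ v Xv → sub v (X⊆Y′ v Xv))

  good⇒partitionable : ∀ {c} → Good full c → Partitionable H f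
  good⇒partitionable {c} g = c , λ i X F X⊆ F⊆ ne →
    let (v , Xv , lt) = g X i (λ _ _ → refl) (λ v Xv → does⇒ (c v ≟ i) (X⊆ v Xv)) ne in
    v , Xv , ≤-<-trans (count-mono (λ e h →
      ∧-true (dec-true (edgeIn? H X e) (F⊆ e (∧-trueˡ {F e} h))) (∧-trueʳ {F e} h))) lt

  MonoOff : VSet H → (V → Fin p) → V → Fin p → Fin (ne H) → Set
  MonoOff Y c z i e = ∀ u → inc H e u ≡ true → u ≢ z → Y u ≡ true × c u ≡ i

  monoOff? : ∀ Y c z i e → Dec (MonoOff Y c z i e)
  monoOff? Y c z i e = all? (λ u → (inc H e u ≟ᵇ true) →-dec (¬? (u ≟ z) →-dec ((Y u ≟ᵇ true) ×-dec (c u ≟ i))))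

  -- The edges at `z` that would join the colour class `i` within `Y` if `z` received the colour
  -- `i`; their number is the degree of `z` in the enlarged class.
  atMono : VSet H → (V → Fin p) → V → Fin p → Fin (ne H) → Bool
  atMono Y c z i e = inc H e z ∧ does (monoOff? Y c z i e)

  atMono-intro : ∀ {Y c z i e} → inc H e z ≡ true → MonoOff Y c z i e → atMono Y c z i e ≡ true
  atMono-intro h m = ∧-true h (dec-true (monoOff? _ _ _ _ _) m)

  atMono-inc : ∀ {Y c z i} e → atMono Y c z i e ≡ true → inc H e z ≡ true
  atMono-inc {z = z} e h = ∧-trueˡ {inc H e z} h

  atMono-mono : ∀ {Y c z i} e → atMono Y c z i e ≡ true → MonoOff Y c z i e
  atMono-mono {Y} {c} {z} {i} e h = does⇒ (monoOff? Y c z i e) (∧-trueʳ {inc H e z} h)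

  atMono-colour : ∀ {Y c z i} e → atMono Y c z i e ≡ true → c (other H z e) ≡ i
  atMono-colour {z = z} e h = proj₂ (atMono-mono e h (other H z e) (other-∈ H z e) (other-≢ H z e))

  -- A test set containing `z` has `z` itself as vertex of small degree, since its edges inside the
  -- set are counted by `atMono`; any other test set already lies in `Y`.
  extend : ∀ {Y Y⁺ c z i} → Good Y c → count (atMono Y c z i) < f z i →
    (∀ v → Y⁺ v ≡ true → v ≢ z → Y v ≡ true) → Good Y⁺ (upd c z i)
  extend {Y} {Y⁺} {c} {z} {i} g lt sub X j X⊆ Xj ne with X z in eq
  ... | true = z , eq , ≤-<-trans (count-mono le) (subst (λ i → count (atMono Y c z i) < f z i) i≡j lt)
    where
    i≡j : i ≡ j
    i≡j = trans (sym (upd-at c z i)) (Xj z eq)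
    le : ∀ e → inside H X e ∧ inc H e z ≡ true → atMono Y c z j e ≡ true
    le e h = atMono-intro (∧-trueʳ {inside H X e} h) (λ u eu u≢z →
      let Xu = does⇒ (edgeIn? H X e) (∧-trueˡ {inside H X e} h) u eu in
      sub u (X⊆ u Xu) u≢z , trans (sym (upd-off c i u≢z)) (Xj u Xu))
  ... | false = g X j (λ v Xv → sub v (X⊆ v Xv) (≢z Xv)) (λ v Xv → trans (sym (upd-off c i (≢z Xv))) (Xj v Xv)) ne
    where
    ≢z : ∀ {v} → X v ≡ true → v ≢ z
    ≢z Xv refl = true≢false Xv eq

  atMono-sum : ∀ Y c z (D : Fin (ne H) → Bool) → (∀ i e → atMono Y c z i e ≡ true → D e ≡ true) →
    ∀ e → count (λ i → atMono Y c z i e) ≤ ind (D e)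
  atMono-sum Y c z D sub = sum-count-disjoint (atMono Y c z) D sub
    (λ i j e h h′ → trans (sym (atMono-colour e h)) (atMono-colour e h′))

  -- If all colours were exhausted, at least Σ f edges at `z` would be monochromatic. But each edge
  -- counts for at most one colour, and the edge to the uncoloured `u` for none, so there are fewer
  -- than the degree of `z`.
  free-colour : ∀ Y c z u → deg H z ≤ sumFin (f z) → Adj H z u → Y u ≡ false →
    ∃[ i ] count (atMono Y c z i) < f z i
  free-colour Y c z u d≤ (z≢u , e₀ , ez , eu) Yu with any? (λ i → count (atMono Y c z i) <? f z i)
  ... | yes h = h
  ... | no ¬h = contradiction d≤ (<⇒≱ (begin-strict
      sumFin (f z)                                              ≤⟨ sum-mono (λ i → ≮⇒≥ (λ lt → ¬h (i , lt))) ⟩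
      sumFin (λ i → count (atMono Y c z i))                     ≡⟨ sum-swap (λ i e → ind (atMono Y c z i e)) ⟩
      sumFin (λ e → count (λ i → atMono Y c z i e))             ≤⟨ sum-mono (atMono-sum Y c z D sub) ⟩
      count D                                                   <⟨ n<1+n _ ⟩
      suc (count D)                                             ≡⟨ +-comm 1 _ ⟩
      count D + 1                                               ≡⟨ cong (count D +_) (sym (ind-true ez)) ⟩
      count D + ind (inc H e₀ z)                                ≡⟨ sym (count-∖ (λ e → inc H e z) e₀) ⟩
      deg H z                                                   ∎))
    where
    open ≤-Reasoning
    D : Fin (ne H) → Bool
    D = (λ e → inc H e z) ∖ e₀
    sub : ∀ i e → atMono Y c z i e ≡ true → D e ≡ true
    sub i e h = ∖-intro (λ e → inc H e z) (atMono-inc e h) λ { refl →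
      true≢false (proj₁ (atMono-mono e h u eu (z≢u ∘ sym))) Yu }

  -- A partition of H − z; the colour that c gives to the hole z is irrelevant.
  State : V → (V → Fin p) → Set
  State z = Good (full ∖ z)

  -- Vertices are coloured in the reverse of the order in which U grows from {z} to all of V.
  greedy : Connected H → (∀ v → deg H v ≤ sumFin (f v)) → ∀ {R : Set} (k : ℕ) (U : VSet H) →
    (∃[ v ] U v ≡ true) → count (λ v → not (U v)) ≤ k →
    (∃ (Good (λ v → not (U v))) → R) → Fin p → R
  greedy conn d≤ k U ne le cont i₀ with any? (λ v → not (U v) ≟ᵇ true)
  ... | no all-in = cont ((λ _ → i₀) , λ X i X⊆ _ (v , Xv) → ⊥-elim (all-in (v , X⊆ v Xv)))
  greedy conn d≤ zero U ne le cont i₀ | yes (v , nUv) = contradiction le (<⇒≱ (count-pos _ v nUv))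
  greedy conn d≤ {R} (suc k) U ne le cont i₀ | yes (v , nUv)
    with proj₂ conn U ne (v , not-elim nUv)
    where
    not-elim : ∀ {b} → not b ≡ true → b ≡ false
    not-elim {false} _ = refl
  ... | e , u , w , eu , Uu , ew , Uw = greedy conn d≤ k U⁺ (u , U⁺u) le⁺ cont⁺ i₀
    where
    U⁺ : VSet H
    U⁺ = upd U w true
    w≢u : w ≢ u
    w≢u refl = true≢false Uu Uw
    U⁺u : U⁺ u ≡ true
    U⁺u = trans (upd-off U true (w≢u ∘ sym)) Uu
    le⁺ : count (λ v → not (U⁺ v)) ≤ k
    le⁺ = ≤-pred (<-≤-trans (count-mono-< imp w (cong not (upd-at U w true)) (cong not Uw)) le)
      where
      imp : ∀ i → not (U⁺ i) ≡ true → not (U i) ≡ true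
      imp i h with i ≟ w
      ... | no _ = h
    -- When `w` is to be coloured, its neighbour `u` in `U` is still uncoloured; this is what leaves
    -- a free colour.
    cont⁺ : ∃ (Good (λ v → not (U⁺ v))) → R
    cont⁺ (c , g) with free-colour (λ v → not (U⁺ v)) c w u (d≤ w) (w≢u , e , ew , eu) (cong not U⁺u)
    ... | i , lt = cont (upd c w i , extend g lt (λ v h v≢w → trans (cong not (upd-off U true v≢w)) h))

  state-exists : Connected H → (∀ v → deg H v ≤ sumFin (f v)) → Fin p → ∀ z → ∃ (State z)
  state-exists conn d≤ i₀ z = greedy conn d≤ _ (λ v → does (v ≟ z)) (z , dec-true (z ≟ z) refl) ≤-refl id i₀

  module Tight (d≤ : ∀ v → deg H v ≤ sumFin (f v)) (np : ¬ Partitionable H f) where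

    module _ {z : V} {c : V → Fin p} (st : State z c) where
      private
        B = atMono (full ∖ z) c z

      -- A colour with room at the hole would extend the state to an f-partition of `H`.
      f≤ : ∀ i → f z i ≤ count (B i)
      f≤ i = ≮⇒≥ (λ lt → np (good⇒partitionable (extend st lt (λ v _ v≢z → ∖-intro full refl v≢z))))

      B-≤ : ∀ e → count (λ i → B i e) ≤ ind (inc H e z)
      B-≤ = atMono-sum (full ∖ z) c z (λ e → inc H e z) (λ i e → atMono-inc e)

      cnt≤ : sumFin (λ i → count (B i)) ≤ sumFin (f z)
      cnt≤ = ≤-trans (≤-reflexive (sum-swap (λ i e → ind (B i e)))) (≤-trans (sum-mono B-≤) (d≤ z))

      -- The chain from Σ f to the number of monochromatic edges at `z`, to the degree, and back to
      -- Σ f collapses: here this gives equality for each colour, in `edge-colour` for each edge.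
      f≡ : ∀ i → f z i ≡ count (B i)
      f≡ = sum-squeeze f≤ cnt≤

      edge-colour : ∀ e → inc H e z ≡ true → ∃[ i ] B i e ≡ true
      edge-colour e ez = count-pos⇒ (λ i → B i e) (≤-reflexive (trans (sym (ind-true ez)) (sym (eqs e))))
        where
        eqs : ∀ e → count (λ i → B i e) ≡ ind (inc H e z)
        eqs = sum-squeeze B-≤ (≤-trans (d≤ z) (≤-trans (sum-mono f≤) (≤-reflexive (sum-swap (λ i e → ind (B i e))))))

      edge-mono : ∀ e → inc H e z ≡ true → ∀ u w → inc H e u ≡ true → inc H e w ≡ true →
        u ≢ z → w ≢ z → c u ≡ c w
      edge-mono e ez u w eu ew u≢z w≢z with edge-colour e ez
      ... | i , h = trans (proj₂ (atMono-mono e h u eu u≢z)) (sym (proj₂ (atMono-mono e h w ew w≢z)))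

      f-count : ∀ i → f z i ≡ count (λ e → inc H e z ∧ does (c (other H z e) ≟ i))
      f-count i = trans (f≡ i) (count-cong (λ e → bool-ext
        (λ h → ∧-true (atMono-inc e h) (dec-true (_ ≟ _) (atMono-colour e h)))
        (λ h → atMono-intro (∧-trueˡ {inc H e z} h) (λ u eu u≢z → ∖-intro full refl u≢z ,
          trans (edge-mono e (∧-trueˡ {inc H e z} h) u (other H z e) eu (other-∈ H z e) u≢z (other-≢ H z e))
            (does⇒ (_ ≟ _) (∧-trueʳ {inc H e z} h))))))

      -- Once `u` is uncoloured, the edge joining it to `z` no longer counts towards the colour
      -- `c u` at `z`, so by tightness there is room for `z` in this colour.
      move : ∀ {u} → Adj H z u → State u (upd c z (c u))
      move {u} (z≢u , e₀ , ez , eu) = extend {Y = Y} (good-⊆ (λ v h → proj₁ (∖-elim (full ∖ z) {u} {v} h)) st)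
        (<-≤-trans lt (≤-reflexive (sym (f≡ (c u)))))
        (λ v h v≢z → ∖-intro (full ∖ z) (∖-intro full refl v≢z) (proj₂ (∖-elim full {u} {v} h)))
        where
        Y : VSet H
        Y = (full ∖ z) ∖ u
        Yu : Y u ≢ true
        Yu h = proj₂ (∖-elim (full ∖ z) {u} {u} h) refl
        lt : count (atMono Y c z (c u)) < count (B (c u))
        lt = count-mono-<
          (λ e h → atMono-intro (atMono-inc e h) (λ w ew w≢z →
            let (a , b) = atMono-mono e h w ew w≢z in proj₁ (∖-elim (full ∖ z) {u} {w} a) , b))
          e₀ (not-true (λ h → Yu (proj₁ (atMono-mono e₀ h u eu (z≢u ∘ sym)))))
          (atMono-intro ez (λ w ew w≢z → ∖-intro full refl w≢z , edge-mono e₀ ez w u ew eu w≢z (z≢u ∘ sym)))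

-- Reachability and separating vertices

reach : ∀ {n} {R : Fin n → Fin n → Set} → (∀ a b → Dec (R a b)) → (u : Fin n) →
  ∃[ X ] (X u ≡ true × (∀ a b → X a ≡ true → R a b → X b ≡ true) × (∀ v → X v ≡ true → Star R u v))
reach {n} {R} R? u = grow _ (λ v → does (v ≟ u)) ≤-refl (dec-true (u ≟ u) refl) start
  where
  start : ∀ v → does (v ≟ u) ≡ true → Star R u v
  start v h with refl ← does⇒ (v ≟ u) h = ε
  grow : ∀ k (X : Fin n → Bool) → count (λ v → not (X v)) ≤ k → X u ≡ true → (∀ v → X v ≡ true → Star R u v) →
    ∃[ X ] (X u ≡ true × (∀ a b → X a ≡ true → R a b → X b ≡ true) × (∀ v → X v ≡ true → Star R u v))
  grow k X le Xu star with any? (λ a → any? (λ b → (X a ≟ᵇ true) ×-dec (R? a b ×-dec (X b ≟ᵇ false))))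
  ... | no closed = X , Xu , cl , star
    where
    cl : ∀ a b → X a ≡ true → R a b → X b ≡ true
    cl a b Xa r with X b in eq
    ... | true  = refl
    ... | false = ⊥-elim (closed (a , b , Xa , r , eq))
  grow zero X le Xu star | yes (a , b , Xa , r , Xb) = contradiction le (<⇒≱ (count-pos _ b (cong not Xb)))
  grow (suc k) X le Xu star | yes (a , b , Xa , r , Xb) = grow k X⁺ le⁺ X⁺u star⁺
    where
    X⁺ : Fin n → Bool
    X⁺ = upd X b true
    X⁺u : X⁺ u ≡ true
    X⁺u with u ≟ b
    ... | yes _ = refl
    ... | no _  = Xu
    le⁺ : count (λ v → not (X⁺ v)) ≤ k
    le⁺ = ≤-pred (<-≤-trans (count-mono-< imp b (cong not (upd-at X b true)) (cong not Xb)) le)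
      where
      imp : ∀ i → not (X⁺ i) ≡ true → not (X i) ≡ true
      imp i h with i ≟ b
      ... | no _ = h
    star⁺ : ∀ v → X⁺ v ≡ true → Star R u v
    star⁺ v h with v ≟ b
    ... | yes refl = star a Xa ◅◅ (r ◅ ε)
    ... | no _     = star v h

Avoid : (H : Hypergraph) → Fin (nv H) → Fin (nv H) → Fin (nv H) → Set
Avoid H w a b = Adj H a b × a ≢ w × b ≢ w

walk-crosses : ∀ {n} {R : Fin n → Fin n → Set} (X : Fin n → Bool) {u v} → Star R u v → X u ≡ true → X v ≡ false →
  ∃[ a ] ∃[ b ] (R a b × X a ≡ true × X b ≡ false)
walk-crosses X ε Xu Xv = ⊥-elim (true≢false Xu Xv)
walk-crosses X (_◅_ {j = m} r rs) Xu Xv with X m in eq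
... | true  = walk-crosses X rs eq Xv
... | false = _ , _ , r , Xu , eq

connected⇒walk : ∀ H → Connected H → ∀ u v → Star (Adj H) u v
connected⇒walk H conn u v with reach (adj? H) u
... | X , Xu , closed , star with X v in eq
... | true = star v eq
... | false with proj₂ conn X (u , Xu) (v , eq)
... | e , a , b , ea , Xa , eb , Xb = ⊥-elim (true≢false (closed a b Xa ((λ { refl → true≢false Xa Xb }) , e , ea , eb)) Xb)

-- `X` is the set of vertices reached from `u` in H - w. If it misses `v`, the two sides are `X`
-- with `w` added and the complement of `X`: all other vertices of an edge that meets `X` are in `X`
-- or equal to `w`.
separating-or-walk : ∀ H w u v → u ≢ w → v ≢ w → Star (Avoid H w) u v ⊎ Separating H w
separating-or-walk H w u v u≢w v≢w
  with reach (λ a b → adj? H a b ×-dec (¬? (a ≟ w) ×-dec ¬? (b ≟ w))) u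
... | X , Xu , closed , star with X v in eq
... | true = inj₁ (star v eq)
... | false with X w ≟ᵇ true
... | yes Xw = ⊥-elim (end-≢ (star w Xw) u≢w refl)
  where
  end-≢ : ∀ {a b} → Star (Avoid H w) a b → a ≢ w → b ≢ w
  end-≢ ε h = h
  end-≢ ((_ , _ , h) ◅ rs) _ = end-≢ rs h
... | no ¬Xw = inj₂ (X₁ , X₂ , cover , inter , X₁w , X₂w ,
    count≥2 X₁ u w (X⊆X₁ Xu) X₁w u≢w , count≥2 X₂ v w (cong not eq) X₂w v≢w , edges)
  where
  X₁ X₂ : VSet H
  X₁ = upd X w true
  X₂ a = not (X a)
  X₁w : X₁ w ≡ true
  X₁w = upd-at X w true
  X₂w : X₂ w ≡ true
  X₂w = cong not (not-true ¬Xw)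
  X⊆X₁ : ∀ {a} → X a ≡ true → X₁ a ≡ true
  X⊆X₁ {a} Xa with a ≟ w
  ... | yes _ = refl
  ... | no _  = Xa
  X₁-elim : ∀ a → X₁ a ≡ true → a ≡ w ⊎ X a ≡ true
  X₁-elim a h with a ≟ w
  ... | yes eq = inj₁ eq
  ... | no _  = inj₂ h
  cover : ∀ a → (X₁ a ≡ true) ⊎ (X₂ a ≡ true)
  cover a with X a ≟ᵇ true
  ... | yes Xa = inj₁ (X⊆X₁ Xa)
  ... | no ¬Xa = inj₂ (cong not (not-true ¬Xa))
  inter : ∀ a → X₁ a ≡ true × X₂ a ≡ true → a ≡ w
  inter a (h₁ , h₂) with X₁-elim a h₁
  ... | inj₁ a≡w = a≡w
  ... | inj₂ Xa = contradiction (trans (sym (cong not Xa)) h₂) (λ ())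
  edges : ∀ e → EdgeIn H X₁ e ⊎ EdgeIn H X₂ e
  edges e with edgeIn? H X₁ e | edgeIn? H X₂ e
  ... | yes h | _     = inj₁ h
  ... | no _  | yes h = inj₂ h
  ... | no h₁ | no h₂ = ⊥-elim (h₂ sub)
    where
    sub : EdgeIn H X₂ e
    sub b eb with X b in Xb
    ... | false = refl
    ... | true = ⊥-elim (h₁ λ a ea → case-a a ea)
      where
      b≢w : b ≢ w
      b≢w refl = ¬Xw Xb
      case-a : ∀ a → inc H e a ≡ true → X₁ a ≡ true
      case-a a ea with a ≟ w | a ≟ b
      ... | yes _   | _        = refl
      ... | no _    | yes refl = Xb
      ... | no a≢w  | no a≢b   = closed b a Xb (((λ eq → a≢b (sym eq)) , e , eb , ea) , b≢w , a≢w)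

-- A walk between the sides has an edge leaving `X₁`. If this edge belonged to the first side, it
-- would not leave; if to the second, its end in `X₁` would be the avoided vertex `w`.
walks⇒no-separating : ∀ H w → (∀ u v → u ≢ w → v ≢ w → Star (Avoid H w) u v) → ¬ Separating H w
walks⇒no-separating H w walk (X₁ , X₂ , cover , inter , X₁w , X₂w , c₁ , c₂ , edges)
  with count≥2⇒ X₁ c₁ w | count≥2⇒ X₂ c₂ w
... | u , X₁u , u≢w | v , X₂v , v≢w
  with walk-crosses X₁ (walk u v u≢w v≢w) X₁u (not-true (λ h → v≢w (inter v (h , X₂v))))
... | a , b , ((_ , e , ea , eb) , a≢w , b≢w) , X₁a , X₁b with edges e
... | inj₁ h = true≢false (h b eb) X₁b
... | inj₂ h = a≢w (inter a (X₁a , h a ea))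

-- Moving the hole in a 2-connected graph

module Graph {n : ℕ} (_~_ : Fin n → Fin n → Set) where

  AvoidG : Fin n → Fin n → Fin n → Set
  AvoidG w a b = a ~ b × a ≢ w × b ≢ w

  -- Invariance under moves of the hole. `St` is left abstract so that further invariants, such as
  -- `Tinted` or `MonoState`, can travel with the state.
  Stable : ∀ {p} → (Fin n → (Fin n → Fin p) → Set) → Set
  Stable St = ∀ {z c u} → St z c → z ~ u → St u (upd c z (c u))

  -- A move overwrites only the vertex that the hole leaves, so the colour of `w` survives a walk
  -- avoiding `w`.
  carry : ∀ {p} {St : Fin n → (Fin n → Fin p) → Set} → Stable St → ∀ {w z u} → Star (AvoidG w) z u →
    ∀ c → St z c → ∃[ c′ ] (St u c′ × c′ w ≡ c w)
  carry stable ε c st = c , st , refl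
  carry stable ((zu , z≢w , _) ◅ rs) c st with carry stable rs _ (stable {c = c} st zu)
  ... | c′ , st′ , eq = c′ , st′ , trans eq (upd-off c _ (z≢w ∘ sym))

  travel : ∀ {p} {St : Fin n → (Fin n → Fin p) → Set} → Stable St → ∀ {z u} → Star _~_ z u →
    ∀ {c} → St z c → ∃ (St u)
  travel stable ε st = _ , st
  travel stable (r ◅ rs) st = travel stable rs (stable st r)

  -- The vertices are `s 0` to `s k`, so `k` is the length minus one; values of `s` beyond `k` carry
  -- no meaning.
  record Cycle (k : ℕ) (s : ℕ → Fin n) : Set where
    field
      distinct : ∀ {i j} → i < j → j ≤ k → s i ≢ s j
      step     : ∀ {i} → i < k → s i ~ s (suc i)
      close    : s k ~ s 0

    distinct′ : ∀ {i j} → i ≤ k → j ≤ k → i ≢ j → s i ≢ s j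
    distinct′ {i} {j} i≤ j≤ i≢j eq with <-cmp i j
    ... | tri< lt _ _ = distinct lt j≤ eq
    ... | tri≈ _ e _ = i≢j e
    ... | tri> _ _ gt = distinct gt i≤ (sym eq)

  open Cycle public

  -- `s 0` has a field of its own because it is adjacent to `s k`.
  record Chordless (k : ℕ) (s : ℕ → Fin n) : Set where
    field
      cycle : Cycle k s
      no-chord₀ : ∀ {j} → 2 ≤ j → j < k → ¬ s 0 ~ s j
      no-chord  : ∀ {i j} → 1 ≤ i → suc i < j → j ≤ k → ¬ s i ~ s j
  open Chordless public

  -- The same cycle read from `s 1` on, with `s 0` placed last. Facts proved for the hole at index 0
  -- reach the other vertices in this way.
  rot : ℕ → (ℕ → Fin n) → ℕ → Fin n
  rot k s i = if does (i <? k) then s (suc i) else s 0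

  rot-< : ∀ {k} (s : ℕ → Fin n) {i} → i < k → rot k s i ≡ s (suc i)
  rot-< {k} s {i} lt rewrite dec-true (i <? k) lt = refl

  rot-k : ∀ k (s : ℕ → Fin n) → rot k s k ≡ s 0
  rot-k k s rewrite dec-false (k <? k) (<-irrefl refl) = refl

module Sliding {n p : ℕ} (_~_ : Fin n → Fin n → Set) (_~?_ : ∀ a b → Dec (a ~ b))
  (~-sym : ∀ {a b} → a ~ b → b ~ a) (~-≢ : ∀ {a b} → a ~ b → a ≢ b)
  (conn : ∀ u v → Star _~_ u v)
  (biconn : ∀ w u v → u ≢ w → v ≢ w → Star (Graph.AvoidG _~_ w) u v)
  (St : Fin n → (Fin n → Fin p) → Set) (stable : Graph.Stable _~_ St)
  (nonmono : ∀ {z c} → St z c → ∃[ u ] ∃[ w ] (u ≢ z × w ≢ z × c u ≢ c w))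
  where

  open Graph _~_

  private
    V = Fin n

  -- Rigid sets

  Constant : (V → Set) → Set
  Constant T = ∀ {z c} → St z c → T z → ∀ {u w} → T u → T w → u ≢ z → w ≢ z → c u ≡ c w

  module Rigid (start : ∃ λ z → ∃ (St z)) (T : V → Set) (T? : ∀ v → Dec (T v)) (a b d : V) (Ta : T a) (Tb : T b) (Td : T d)
    (a≢b : a ≢ b) (a≢d : a ≢ d) (b≢d : b ≢ d) (rigid : Constant T) where

    pick : ∀ x y → ∃[ r ] (T r × r ≢ x × r ≢ y)
    pick x y with a ≟ x | a ≟ y | b ≟ x | b ≟ y
    ... | no h  | no h′ | _     | _     = a , Ta , h , h′
    ... | yes refl | _ | _ | no h = b , Tb , (a≢b ∘ sym) , h
    ... | yes refl | _ | _ | yes refl = d , Td , (a≢d ∘ sym) , (b≢d ∘ sym)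
    ... | no _ | yes refl | no h | _ = b , Tb , h , (a≢b ∘ sym)
    ... | no _ | yes refl | yes refl | _ = d , Td , (b≢d ∘ sym) , (a≢d ∘ sym)

    -- Once the hole leaves T, at most the vertex x by which it left loses the colour i.
    Tinted : Fin p → V → (V → Fin p) → Set
    Tinted i z c = St z c × ∃[ x ] (∀ r → T r → r ≢ x → r ≢ z → c r ≡ i)

    -- If the hole leaves a vertex `z` of `T`, rigidity gives all of `T` off `z` one colour, which a
    -- vertex of `T` other than `x` and `z` shows to be `i`; then `z` is the new exception. A hole
    -- outside `T` overwrites nothing in `T`.
    tinted-stable : ∀ i → Stable (Tinted i)
    tinted-stable i {z} {c} {u} (st , x , tint) zu with T? z
    ... | no ¬Tz = stable st zu , x , λ r Tr r≢x _ →
      trans (upd-off c _ (λ { refl → ¬Tz Tr })) (tint r Tr r≢x (λ { refl → ¬Tz Tr }))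
    ... | yes Tz with pick x z
    ... | r₀ , Tr₀ , r₀≢x , r₀≢z = stable st zu , z , λ r Tr r≢z _ →
      trans (upd-off c _ r≢z) (trans (rigid st Tz Tr Tr₀ r≢z r₀≢z) (tint r₀ Tr₀ r₀≢x r₀≢z))

    Agrees : V → Set
    Agrees y = ∀ {z c r} → St z c → T z → z ≢ y → T r → r ≢ z → c y ≡ c r

    -- Suppose that `x` differs from `T`. The hole goes to `y` avoiding `x`, steps to `x`, which
    -- copies the colour of `x` to `y`, and returns to `T` avoiding `y`. Since `T` stays tinted with
    -- its old colour, `y` now disagrees with `T`.
    agrees-step : ∀ {y x} → y ~ x → Agrees y → Agrees x
    agrees-step {y} {x} yx agr {z} {c} {r} st Tz z≢x Tr r≢z with c x ≟ c r
    ... | yes eq = eq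
    ... | no c≢ with carry {St = Tinted (c r)} (λ {_} {c′} → tinted-stable (c r) {c = c′}) (biconn x z y z≢x (~-≢ yx)) c
                       (st , z , λ r′ Tr′ r′≢z _ → rigid st Tz Tr′ Tr r′≢z r≢z)
    ... | c₁ , st₁ , eq₁ with pick y y
    ... | q , Tq , q≢y , _ with carry {St = Tinted (c r)} (λ {_} {c′} → tinted-stable (c r) {c = c′}) (biconn y x q (~-≢ yx ∘ sym) q≢y) (upd c₁ y (c₁ x))
                                  (tinted-stable (c r) {c = c₁} st₁ yx)
    ... | c₃ , (st₃ , x₀ , tint) , eq₃ with pick q x₀
    ... | r′ , Tr′ , r′≢q , r′≢x₀ = contradiction
      (trans (sym (trans eq₃ (trans (upd-at c₁ y _) eq₁))) (trans (agr st₃ Tq q≢y Tr′ r′≢q) (tint r′ Tr′ r′≢x₀ r′≢q))) c≢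

    agrees : ∀ {y x} → Star _~_ y x → Agrees y → Agrees x
    agrees ε h = h
    agrees (r ◅ rs) h = agrees rs (agrees-step r h)

    -- Agreement spreads from `a` along walks to every vertex, so with the hole at `a` all other
    -- vertices would have the same colour.
    absurd : ⊥
    absurd with travel stable (conn _ a) (proj₂ (proj₂ start))
    ... | c , st with nonmono st
    ... | u , w , u≢a , w≢a , c≢ = c≢ (trans (all u u≢a) (sym (all w w≢a)))
      where
      all : ∀ y → y ≢ a → c y ≡ c b
      all y y≢a = agrees (conn a y) (λ st′ Tz z≢a Tr r≢z → rigid st′ Tz Ta Tr (z≢a ∘ sym) r≢z) st Ta (y≢a ∘ sym) Tb (a≢b ∘ sym)

  -- Induced paths and chordless cycles

  Path : V → List V → Set
  Path u [] = ⊤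
  Path u (w ∷ l) = u ~ w × All (λ v → u ≢ v × ¬ u ~ v) l × Path w l

  end : V → List V → V
  end u [] = u
  end u (w ∷ l) = end w l

  nth : V → List V → ℕ → V
  nth u l       zero    = u
  nth u []      (suc i) = u
  nth u (w ∷ l) (suc i) = nth w l i

  nth-end : ∀ u l → nth u l (length l) ≡ end u l
  nth-end u []      = refl
  nth-end u (w ∷ l) = nth-end w l

  nth-all : ∀ {Q : V → Set} {u l} → Q u → All Q l → ∀ i → Q (nth u l i)
  nth-all q qs zero = q
  nth-all q [] (suc i) = q
  nth-all q (q′ ∷ qs) (suc i) = nth-all q′ qs i

  path-step : ∀ {u} l → Path u l → ∀ {i} → i < length l → nth u l i ~ nth u l (suc i)
  path-step (w ∷ l) (uw , _ , _) {zero}  _ = uw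
  path-step (w ∷ l) (_ , _ , pth) {suc i} (s≤s lt) = path-step l pth lt

  path-far : ∀ {u} l → Path u l → ∀ {i j} → suc i < j → j ≤ length l → nth u l i ≢ nth u l j × ¬ nth u l i ~ nth u l j
  path-far (w ∷ l) (_ , far , _) {zero} {suc (suc j)} _ (s≤s le) = far-nth l far j le
    where
    far-nth : ∀ {Q : V → Set} {w} l → All Q l → ∀ j → suc j ≤ length l → Q (nth w l (suc j))
    far-nth (w ∷ l) (q ∷ qs) j _ = nth-all q qs j
  path-far (w ∷ l) (_ , _ , pth) {suc i} {suc j} (s≤s lt) (s≤s le) = path-far l pth lt le
  path-far (w ∷ l) _ {zero} {suc zero} (s≤s ()) _

  -- Prepending u to an induced path keeps it induced if the path is cut at the last vertex equal or adjacent to u.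
  attach : ∀ {Q : V → Set} u v l → Path v l → Q v → All Q l →
    (∃[ l′ ] (Path u l′ × end u l′ ≡ end v l × All Q l′)) ⊎ All (λ w → u ≢ w × ¬ u ~ w) (v ∷ l)
  attach {Q} u v l pth qv ql = case-l (rest l pth ql)
    where
    rest : ∀ l → Path v l → All Q l →
      (∃[ l′ ] (Path u l′ × end u l′ ≡ end v l × All Q l′)) ⊎ All (λ w → u ≢ w × ¬ u ~ w) l
    rest [] _ _ = inj₂ []
    rest (w ∷ l) (_ , _ , pth) (qw ∷ ql) = attach u w l pth qw ql
    case-l : (∃[ l′ ] (Path u l′ × end u l′ ≡ end v l × All Q l′)) ⊎ All (λ w → u ≢ w × ¬ u ~ w) l →
      (∃[ l′ ] (Path u l′ × end u l′ ≡ end v l × All Q l′)) ⊎ All (λ w → u ≢ w × ¬ u ~ w) (v ∷ l)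
    case-l (inj₁ r) = inj₁ r
    case-l (inj₂ none) with u ≟ v | u ~? v
    ... | yes refl | _ = inj₁ (l , pth , refl , ql)
    ... | no _ | yes uv = inj₁ (v ∷ l , (uv , none , pth) , refl , qv ∷ ql)
    ... | no u≢v | no u≁v = inj₂ ((u≢v , u≁v) ∷ none)

  induced-path : ∀ {z u v} → Star (AvoidG z) u v → ∃[ l ] (Path u l × end u l ≡ v × All (_≢ z) l)
  induced-path ε = [] , tt , refl , []
  induced-path (_◅_ {j = w} (uw , _ , w≢z) rs) with induced-path rs
  ... | l , pth , eq , avoid with attach _ w l pth w≢z avoid
  ... | inj₁ (l′ , pth′ , eq′ , avoid′) = l′ , pth′ , trans eq′ eq , avoid′
  ... | inj₂ ((_ , u≁w) ∷ _) = contradiction uw u≁w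

  -- The last vertex is exempt: through it `z` will close the cycle.
  Inner : V → V → List V → Set
  Inner z u [] = ⊤
  Inner z u (w ∷ l) = (¬ z ~ u) × Inner z w l

  inner-nth : ∀ {z u} l → Inner z u l → ∀ {i} → i < length l → ¬ z ~ nth u l i
  inner-nth (w ∷ l) (h , _) {zero} _ = h
  inner-nth (w ∷ l) (_ , hs) {suc i} (s≤s lt) = inner-nth l hs lt

  -- The path is cut at its first vertex adjacent to `z`. The last component records, for arbitrary
  -- `Q`, that no vertex is added.
  truncate : ∀ {z u} l → Path u l → z ~ end u l →
    ∃[ l′ ] (Path u l′ × z ~ end u l′ × Inner z u l′ × (∀ {Q : V → Set} → All Q l → All Q l′))
  truncate [] pth zl = [] , tt , zl , tt , λ q → q
  truncate {z} {u} (w ∷ l) (uw , far , pth) zl with z ~? u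
  ... | yes zu = [] , tt , zu , tt , λ _ → []
  ... | no z≁u with truncate l pth zl
  ... | l′ , pth′ , zl′ , inner , sub = w ∷ l′ , (uw , sub far , pth′) , zl′ , (z≁u , inner) , λ { (q ∷ qs) → q ∷ sub qs }

  -- `z` is put in front as `s 0`; `Inner` excludes chords at `z`, and the path is induced. As `z`
  -- is not adjacent to `w`, the list `l` is nonempty, so there are at least four vertices.
  close-path : ∀ {z u w l} → Path u (w ∷ l) → z ~ u → ¬ z ~ w → z ~ end w l → Inner z w l → u ≢ z → All (_≢ z) (w ∷ l) →
    ∃[ k ] ∃[ s ] (3 ≤ k × Chordless k s)
  close-path {l = []} _ _ z≁w zw _ _ _ = contradiction zw z≁w
  close-path {z} {u} {w} {l@(_ ∷ _)} pth zu z≁w zl inner u≢z avoid = suc (length (w ∷ l)) , s , s≤s (s≤s (s≤s z≤n)) , record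
    { cycle = record
      { distinct = dist
      ; step = adj
      ; close = ~-sym (subst (z ~_) (sym (nth-end w l)) zl) }
    ; no-chord₀ = λ { {suc (suc j)} (s≤s (s≤s _)) (s≤s (s≤s lt)) → inner-nth l inner lt }
    ; no-chord = λ { {suc i} {suc j} (s≤s _) (s≤s lt) (s≤s le) → proj₂ (path-far (w ∷ l) pth lt le) } }
    where
    s : ℕ → V
    s zero    = z
    s (suc i) = nth u (w ∷ l) i
    dist : ∀ {i j} → i < j → j ≤ suc (length (w ∷ l)) → s i ≢ s j
    dist {zero} {suc j} _ _ = nth-all u≢z avoid j ∘ sym
    dist {suc i} {suc j} (s≤s lt) (s≤s le) with m≤n⇒m<n∨m≡n lt
    ... | inj₁ far = proj₁ (path-far (w ∷ l) pth far le)
    ... | inj₂ refl = ~-≢ (path-step (w ∷ l) pth le)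
    adj : ∀ {i} → i < suc (length (w ∷ l)) → s i ~ s (suc i)
    adj {zero} _ = zu
    adj {suc i} (s≤s lt) = path-step (w ∷ l) pth lt

  rot-cycle : ∀ {k s} → 1 ≤ k → Cycle k s → Cycle k (rot k s)
  rot-cycle {k} {s} k≥1 cy = record { distinct = dist ; step = adj ; close = cl }
    where
    dist : ∀ {i j} → i < j → j ≤ k → rot k s i ≢ rot k s j
    dist {i} {j} lt le with m≤n⇒m<n∨m≡n le
    ... | inj₁ j<k rewrite rot-< s (<-trans lt j<k) | rot-< s j<k = distinct cy (s≤s lt) j<k
    ... | inj₂ refl rewrite rot-< s lt | rot-k k s = distinct cy (s≤s z≤n) lt ∘ sym
    adj : ∀ {i} → i < k → rot k s i ~ rot k s (suc i)
    adj {i} lt with m≤n⇒m<n∨m≡n lt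
    ... | inj₁ lt′ rewrite rot-< s lt | rot-< s lt′ = step cy lt′
    ... | inj₂ refl rewrite rot-< s lt | rot-k k s = close cy
    cl : rot k s k ~ rot k s 0
    cl rewrite rot-k k s | rot-< s k≥1 = step cy k≥1

  rot-chordless : ∀ {k s} → 1 ≤ k → Chordless k s → Chordless k (rot k s)
  rot-chordless {k} {s} k≥1 ch = record { cycle = rot-cycle k≥1 (cycle ch) ; no-chord₀ = nc₀ ; no-chord = nc }
    where
    nc₀ : ∀ {j} → 2 ≤ j → j < k → ¬ rot k s 0 ~ rot k s j
    nc₀ 2≤j j<k rewrite rot-< s k≥1 | rot-< s j<k = no-chord ch ≤-refl (s≤s 2≤j) j<k
    nc : ∀ {i j} → 1 ≤ i → suc i < j → j ≤ k → ¬ rot k s i ~ rot k s j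
    nc {i} {j} 1≤i lt le with m≤n⇒m<n∨m≡n le
    ... | inj₁ j<k rewrite rot-< s (<-trans (<⇒≤ lt) j<k) | rot-< s j<k = no-chord ch (s≤s z≤n) (s≤s lt) j<k
    ... | inj₂ refl rewrite rot-< s (<⇒≤ lt) | rot-k k s = λ adj → no-chord₀ ch (s≤s 1≤i) lt (~-sym adj)

  rotN : ℕ → ℕ → (ℕ → V) → ℕ → V
  rotN k zero    s = s
  rotN k (suc m) s = rotN k m (rot k s)

  rotN-chordless : ∀ {k} m {s} → 1 ≤ k → Chordless k s → Chordless k (rotN k m s)
  rotN-chordless zero    k≥1 ch = ch
  rotN-chordless (suc m) k≥1 ch = rotN-chordless m k≥1 (rot-chordless k≥1 ch)

  rotN-≤ : ∀ {k} m (s : ℕ → V) {i} → i + m ≤ k → rotN k m s i ≡ s (i + m)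
  rotN-≤ zero s {i} le rewrite +-identityʳ i = refl
  rotN-≤ {k} (suc m) s {i} le rewrite +-suc i m = trans (rotN-≤ m (rot k s) (<⇒≤ le)) (rot-< s le)

  -- Indices count modulo k + 1; this is the case of one wrap-around.
  rotN-wrap : ∀ {k} m (s : ℕ → V) {i j} → i + m ≡ suc (k + j) → i ≤ k → j ≤ k → rotN k m s i ≡ s j
  rotN-wrap {k} zero s {i} {j} eq i≤k j≤k =
    contradiction i≤k (<⇒≱ (≤-trans (s≤s (m≤m+n k j)) (≤-reflexive (trans (sym eq) (+-identityʳ i)))))
  rotN-wrap {k} (suc m) s {i} {j} eq i≤k j≤k with suc-injective (trans (sym (+-suc i m)) eq)
  rotN-wrap {k} (suc m) s {i} {zero} eq i≤k j≤k | eq′ rewrite +-identityʳ k =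
    trans (rotN-≤ m (rot k s) (≤-reflexive eq′)) (trans (cong (rot k s) eq′) (rot-k k s))
  rotN-wrap {k} (suc m) s {i} {suc j} eq i≤k j≤k | eq′ =
    trans (rotN-wrap m (rot k s) (trans eq′ (+-suc k j)) i≤k (<⇒≤ j≤k)) (rot-< s j≤k)

  -- Edge multiplicities and the balance of colours on a cycle

  module Weighted (m : V → V → ℕ) (m-pos : ∀ {a b} → a ~ b → 1 ≤ m a b) (m-zero : ∀ {a b} → ¬ a ~ b → m a b ≡ 0)
    (m-sym : ∀ a b → m a b ≡ m b a)
    (f : V → Fin p → ℕ) (start : ∃ λ z → ∃ (St z))
    (f-sum : ∀ {z c} → St z c → ∀ i → f z i ≡ sumFin (λ u → m z u * ind (does (c u ≟ i)))) where

    OnCycle : ℕ → (ℕ → V) → V → Set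
    OnCycle k s v = ∃[ i ] (i < suc k × s i ≡ v)

    on-cycle? : ∀ k (s : ℕ → V) v → Dec (OnCycle k s v)
    on-cycle? k s v = anyUpTo? (λ i → s i ≟ v) (suc k)

    slide : ∀ {k s c} → Cycle k s → St (s 0) c → ∀ r → r ≤ k →
      ∃[ c′ ] (St (s r) c′ × (∀ j → j < r → c′ (s j) ≡ c (s (suc j))) ×
               (∀ v → (∀ j → j < r → v ≢ s j) → c′ v ≡ c v))
    slide cy st zero le = _ , st , (λ j ()) , λ v _ → refl
    slide {k} {s} {c} cy st (suc r) le with slide cy st r (<⇒≤ le)
    ... | c′ , st′ , moved , fixed = upd c′ (s r) (c′ (s (suc r))) , stable st′ (step cy le) , moved′ , fixed′
      where
      moved′ : ∀ j → j < suc r → upd c′ (s r) (c′ (s (suc r))) (s j) ≡ c (s (suc j))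
      moved′ j lt with m≤n⇒m<n∨m≡n (≤-pred lt)
      ... | inj₁ j<r = trans (upd-off c′ _ (distinct cy j<r (<⇒≤ le))) (moved j j<r)
      ... | inj₂ refl = trans (upd-at c′ (s r) _) (fixed _ (λ j lt → distinct cy (<-trans lt (n<1+n r)) le ∘ sym))
      fixed′ : ∀ v → (∀ j → j < suc r → v ≢ s j) → upd c′ (s r) (c′ (s (suc r))) v ≡ c v
      fixed′ v h = trans (upd-off c′ _ (h r ≤-refl)) (fixed v (λ j lt → h j (<-trans lt (n<1+n r))))

    -- The colour of `s 1` moves twice, to `s 0` in the first step and from there to `s k` in the
    -- last; the other colours go back by one place.
    rotate : ∀ {k s c} → 1 ≤ k → Cycle k s → St (s 0) c →
      ∃[ c′ ] (St (s 0) c′ × (∀ j → j < k → c′ (s j) ≡ c (s (suc j))) × c′ (s k) ≡ c (s 1) ×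
               (∀ v → (∀ j → j ≤ k → v ≢ s j) → c′ v ≡ c v))
    rotate {k} {s} {c} k≥1 cy st with slide cy st k ≤-refl
    ... | c′ , st′ , moved , fixed = upd c′ (s k) (c′ (s 0)) , stable st′ (close cy)
      , (λ j lt → trans (upd-off c′ _ (distinct cy lt ≤-refl)) (moved j lt))
      , trans (upd-at c′ (s k) _) (moved 0 k≥1)
      , (λ v h → trans (upd-off c′ _ (h k ≤-refl)) (fixed v (λ j lt → h j (<⇒≤ lt))))

    module _ {k s c} (k≥2 : 2 ≤ k) (cy : Cycle k s) (free : ∀ {j} → 2 ≤ j → j < k → ¬ s 0 ~ s j) (st : St (s 0) c) where
      private
        k≥1 : 1 ≤ k
        k≥1 = <⇒≤ k≥2
        m₁ = m (s 0) (s 1)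
        mₖ = m (s 0) (s k)
        m₁≥1 : 1 ≤ m₁
        m₁≥1 = m-pos (step cy k≥1)
        mₖ≥1 : 1 ≤ mₖ
        mₖ≥1 = m-pos (~-sym (close cy))

      -- After a full turn of the hole only colours on the cycle have changed, and of these s 0 sees only those of s 1 and s k.
      balance : ∀ i → m₁ * ind (does (c (s 2) ≟ i)) + mₖ * ind (does (c (s 1) ≟ i))
                    ≡ m₁ * ind (does (c (s 1) ≟ i)) + mₖ * ind (does (c (s k) ≟ i))
      balance i with rotate k≥1 cy st
      ... | c′ , st′ , moved , last , fixed = subst₂ (λ x y → m₁ * ind (does (x ≟ i)) + mₖ * ind (does (y ≟ i)) ≡ g (s 1) + g (s k))
          (moved 1 k≥2) last (+-cancelˡ-≡ (sumFin g) _ _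
          (trans (sum-at₂ g g′ (s 1) (s k) (distinct cy k≥2 ≤-refl) off) (cong (_+ (g (s 1) + g (s k)))
            (trans (sym (f-sum st′ i)) (f-sum st i)))))
        where
        g g′ : V → ℕ
        g u = m (s 0) u * ind (does (c u ≟ i))
        g′ u = m (s 0) u * ind (does (c′ u ≟ i))
        zeros : ∀ u → ¬ s 0 ~ u → g u ≡ g′ u
        zeros u h rewrite m-zero h = refl
        off : ∀ u → u ≢ s 1 → u ≢ s k → g u ≡ g′ u
        off u u≢1 u≢k with on-cycle? k s u
        ... | no h = cong (λ x → m (s 0) u * ind (does (x ≟ i))) (sym (fixed u (λ j le eq → h (j , s≤s le , sym eq))))
        ... | yes (zero , _ , refl) = zeros _ (λ a → ~-≢ a refl)
        ... | yes (suc zero , _ , refl) = contradiction refl u≢1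
        ... | yes (suc (suc j) , le , refl) with m≤n⇒m<n∨m≡n (≤-pred le)
        ... | inj₁ lt = zeros _ (free (s≤s (s≤s z≤n)) lt)
        ... | inj₂ refl = contradiction refl u≢k

      -- By `balance` for the colour of `s 2`: if `s k` had another colour, `m₁` or `mₖ` would
      -- vanish.
      alternate : c (s 2) ≡ c (s k)
      alternate with c (s 2) ≟ c (s k)
      ... | yes eq = eq
      ... | no neq with balance (c (s 2))
      ... | e rewrite dec-true (c (s 2) ≟ c (s 2)) refl | dec-false (c (s k) ≟ c (s 2)) (neq ∘ sym)
              | *-identityʳ m₁ | *-zeroʳ mₖ with c (s 1) ≟ c (s 2)
      ... | yes _ rewrite *-identityʳ m₁ | *-identityʳ mₖ = contradiction (+-cancelˡ-≡ m₁ _ _ e) (λ h → <⇒≢ mₖ≥1 (sym h))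
      ... | no _ rewrite *-zeroʳ m₁ | *-zeroʳ mₖ = contradiction (trans (sym (+-identityʳ m₁)) e) (λ h → <⇒≢ m₁≥1 (sym h))

      -- `balance` for the colour of `s 1`, which neither `s 2` nor `s k` has, leaves one weight on
      -- each side.
      uniform : c (s 1) ≢ c (s k) → m₁ ≡ mₖ
      uniform neq with balance (c (s 1))
      ... | e rewrite alternate | dec-true (c (s 1) ≟ c (s 1)) refl | dec-false (c (s k) ≟ c (s 1)) (neq ∘ sym)
              | *-identityʳ m₁ | *-identityʳ mₖ | *-zeroʳ m₁ | *-zeroʳ mₖ = sym (trans e (+-identityʳ m₁))

    -- Moving the hole along the cycle permutes the colours of the cycle, so constancy need only be known for the hole at s 0.
    constant-cycle : ∀ {k s} → 2 ≤ k → Cycle k s →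
      (∀ {c} → St (s 0) c → ∀ {i j} → 1 ≤ i → i ≤ k → 1 ≤ j → j ≤ k → c (s i) ≡ c (s j)) → ⊥
    constant-cycle {k} {s} k≥2 cy const = Rigid.absurd start T (on-cycle? k s) (s 0) (s 1) (s 2)
      (0 , s≤s z≤n , refl) (1 , s≤s (<⇒≤ k≥2) , refl) (2 , s≤s k≥2 , refl)
      (distinct cy (s≤s z≤n) (<⇒≤ k≥2)) (distinct cy (s≤s z≤n) k≥2) (distinct cy (s≤s (s≤s z≤n)) k≥2) rigid
      where
      T : V → Set
      T = OnCycle k s
      ConstantAt : ℕ → Set
      ConstantAt r = ∀ {c} → St (s r) c → ∀ {i j} → i ≤ k → j ≤ k → i ≢ r → j ≢ r → c (s i) ≡ c (s j)
      at-0 : ConstantAt 0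
      at-0 st i≤ j≤ i≢ j≢ = const st (n≢0⇒n>0 i≢) i≤ (n≢0⇒n>0 j≢) j≤
      -- Moving the hole from `s r` to `s r′` puts the colour of `s r′` at `s r`, where constancy
      -- for the hole at `s r′` compares it with the rest.
      back : ∀ {r r′} → r ≤ k → r′ ≤ k → r ≢ r′ → s r ~ s r′ → ConstantAt r′ → ConstantAt r
      back {r} {r′} r≤ r′≤ r≢r′ adj at-r′ {c} st {i} {j} i≤ j≤ i≢r j≢r = trans (new i i≤ i≢r) (sym (new j j≤ j≢r))
        where
        c′ = upd c (s r) (c (s r′))
        new : ∀ i → i ≤ k → i ≢ r → c (s i) ≡ c′ (s r)
        new i i≤ i≢r with i ≟ℕ r′
        ... | yes refl = sym (upd-at c (s r) _)
        ... | no i≢r′ = trans (sym (upd-off c _ (distinct′ cy i≤ r≤ i≢r))) (at-r′ (stable st adj) i≤ r≤ i≢r′ r≢r′)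
      -- The induction runs backwards from `s k`, which is next to `s 0`.
      at : ∀ d r → r + d ≡ k → ConstantAt r
      at zero r eq rewrite +-identityʳ r | eq = back ≤-refl z≤n (λ e → <⇒≢ (<-trans (s≤s z≤n) k≥2) (sym e)) (close cy) at-0
      at (suc d) r eq = back (<⇒≤ r<k) r<k (<⇒≢ ≤-refl) (step cy r<k) (at d (suc r) (trans (sym (+-suc r d)) eq))
        where
        r<k : r < k
        r<k = ≤-trans (m<m+n r (s≤s z≤n)) (≤-reflexive eq)
      rigid : Constant T
      rigid st (r , r< , refl) (i , i< , refl) (j , j< , refl) i≢r j≢r =
        at (k ∸ r) r (m+[n∸m]≡n (≤-pred r<)) st (≤-pred i<) (≤-pred j<) (λ { refl → i≢r refl }) (λ { refl → j≢r refl })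

    -- If the weights at `x` differ, `uniform` gives `y` and `z` the same colour whenever the hole
    -- is at `x`, against `constant-cycle`. For a triangle the condition on chords is void.
    triangle : ∀ {x y z} → x ~ y → y ~ z → z ~ x → m x y ≡ m x z
    triangle {x} {y} {z} xy yz zx with m x y ≟ℕ m x z
    ... | yes eq = eq
    ... | no neq = ⊥-elim (constant-cycle ≤-refl cy const)
      where
      s : ℕ → V
      s 0 = x
      s 1 = y
      s _ = z
      cy : Cycle 2 s
      cy = record { distinct = dist ; step = adj ; close = zx }
        where
        dist : ∀ {i j} → i < j → j ≤ 2 → s i ≢ s j
        dist {0} {1} _ _ = ~-≢ xy
        dist {0} {2} _ _ = ~-≢ zx ∘ sym
        dist {1} {2} _ _ = ~-≢ yz
        dist {suc _} {1} (s≤s ()) _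
        dist {suc (suc _)} {2} (s≤s (s≤s ())) _
        dist {_} {suc (suc (suc _))} _ (s≤s (s≤s ()))
        adj : ∀ {i} → i < 2 → s i ~ s (suc i)
        adj {0} _ = xy
        adj {1} _ = yz
        adj {suc (suc _)} (s≤s (s≤s ()))
      same : ∀ {c} → St x c → c y ≡ c z
      same {c} st with c y ≟ c z
      ... | yes eq = eq
      ... | no c≢ = contradiction (uniform ≤-refl cy (λ 2≤j j<2 _ → <⇒≱ j<2 2≤j) st c≢) neq
      const : ∀ {c} → St x c → ∀ {i j} → 1 ≤ i → i ≤ 2 → 1 ≤ j → j ≤ 2 → c (s i) ≡ c (s j)
      const st {1} {1} _ _ _ _ = refl
      const st {1} {2} _ _ _ _ = same st
      const st {2} {1} _ _ _ _ = sym (same st)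
      const st {2} {2} _ _ _ _ = refl
      const st {suc (suc (suc _))} _ (s≤s (s≤s ()))
      const st {_} {suc (suc (suc _))} _ _ _ (s≤s (s≤s ()))

    module Quad {x z y w} (x≢y : x ≢ y) (x≁y : ¬ x ~ y) (z≢w : z ≢ w)
      (xz : x ~ z) (zy : z ~ y) (yw : y ~ w) (wx : w ~ x) where
      s : ℕ → V
      s 0 = x
      s 1 = z
      s 2 = y
      s _ = w
      cy : Cycle 3 s
      cy = record { distinct = dist ; step = adj ; close = wx }
        where
        dist : ∀ {i j} → i < j → j ≤ 3 → s i ≢ s j
        dist {0} {1} _ _ = ~-≢ xz
        dist {0} {2} _ _ = x≢y
        dist {0} {3} _ _ = ~-≢ wx ∘ sym
        dist {1} {2} _ _ = ~-≢ zy
        dist {1} {3} _ _ = z≢w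
        dist {2} {3} _ _ = ~-≢ yw
        dist {suc _} {1} (s≤s ()) _
        dist {suc (suc _)} {2} (s≤s (s≤s ())) _
        dist {suc (suc (suc _))} {3} (s≤s (s≤s (s≤s ()))) _
        dist {_} {suc (suc (suc (suc _)))} _ (s≤s (s≤s (s≤s ())))
        adj : ∀ {i} → i < 3 → s i ~ s (suc i)
        adj {0} _ = xz
        adj {1} _ = zy
        adj {2} _ = yw
        adj {suc (suc (suc _))} (s≤s (s≤s (s≤s ())))
      free : ∀ {j} → 2 ≤ j → j < 3 → ¬ x ~ s j
      free {2} _ _ = x≁y
      free {0} () _
      free {1} (s≤s ()) _
      free {suc (suc (suc _))} _ (s≤s (s≤s (s≤s ())))
      y≡w : ∀ {c} → St x c → c y ≡ c w
      y≡w = alternate (s≤s (s≤s z≤n)) cy free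

    -- With the hole at `x`, `alternate` says that `y` and `w` agree, and on the reversed cycle that
    -- `y` and `z` agree. Only chords at `x` matter, so `z` and `w` may be adjacent.
    quad : ∀ {x z y w} → x ≢ y → ¬ x ~ y → z ≢ w → x ~ z → z ~ y → y ~ w → w ~ x → ⊥
    quad {x} {z} {y} {w} x≢y x≁y z≢w xz zy yw wx = constant-cycle (s≤s (s≤s z≤n)) Q.cy
        (λ st i≥1 i≤ j≥1 j≤ → trans (to-y st i≥1 i≤) (sym (to-y st j≥1 j≤)))
      where
      module Q = Quad x≢y x≁y z≢w xz zy yw wx
      module Q′ = Quad x≢y x≁y (z≢w ∘ sym) (~-sym wx) (~-sym yw) (~-sym zy) (~-sym xz)
      to-y : ∀ {c} → St x c → ∀ {i} → 1 ≤ i → i ≤ 3 → c (Q.s i) ≡ c y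
      to-y st {1} _ _ = sym (Q′.y≡w st)
      to-y st {2} _ _ = refl
      to-y st {3} _ _ = sym (Q.y≡w st)
      to-y st {suc (suc (suc (suc _)))} _ (s≤s (s≤s (s≤s ())))

    -- Chordless cycles with at least five vertices

    on-cycle-rot : ∀ {k s v} → OnCycle k (rot k s) v → OnCycle k s v
    on-cycle-rot {k} {s} (i , lt , eq) with m≤n⇒m<n∨m≡n (≤-pred lt)
    ... | inj₁ i<k = suc i , s≤s i<k , trans (sym (rot-< s i<k)) eq
    ... | inj₂ refl = 0 , s≤s z≤n , trans (sym (rot-k k s)) eq

    -- One step of the hole, with indices rotated so that it is at index 0 again. The colour of
    -- `s 1` arrives at index `k`; every other index falls by one.
    module Turn {k s c} (k≥1 : 1 ≤ k) (cy : Cycle k s) (st : St (s 0) c) where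
      turned : V → Fin p
      turned = upd c (s 0) (c (s 1))

      turned-state : St (rot k s 0) turned
      turned-state rewrite rot-< s k≥1 = stable st (step cy k≥1)

      turned-< : ∀ {i} → i < k → turned (rot k s i) ≡ c (s (suc i))
      turned-< {i} lt rewrite rot-< s lt = upd-off c _ (distinct cy (s≤s z≤n) lt ∘ sym)

      turned-k : turned (rot k s k) ≡ c (s 1)
      turned-k rewrite rot-k k s = upd-at c (s 0) _

    -- After one turn, `alternate` compares the old colours of `s 3` and `s 1`; further turns shift
    -- the indices.
    period : ∀ r {k s c} → 2 ≤ k → Chordless k s → St (s 0) c → 1 ≤ r → suc (suc r) ≤ k → c (s (suc (suc r))) ≡ c (s r)
    period (suc zero) {k} {s} k≥2 ch st _ le = trans (sym (turned-< le))
        (trans (alternate k≥2 (cycle ch′) (no-chord₀ ch′) turned-state) turned-k)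
      where
      open Turn (<⇒≤ k≥2) (cycle ch) st
      ch′ = rot-chordless (<⇒≤ k≥2) ch
    period (suc (suc r)) k≥2 ch st _ le = trans (sym (turned-< le))
        (trans (period (suc r) k≥2 (rot-chordless (<⇒≤ k≥2) ch) turned-state (s≤s z≤n) (<⇒≤ le)) (turned-< (<⇒≤ (<⇒≤ le))))
      where
      open Turn (<⇒≤ k≥2) (cycle ch) st

    -- The run stops at its first vertex on the cycle, so only vertices off the cycle are
    -- overwritten.
    first-hit : ∀ {k s z y u} → Star (AvoidG z) y u → y ≢ z → OnCycle k s u →
      ∃[ q ] (OnCycle k s q × q ≢ z × (∀ c → St y c → ∃[ c′ ] (St q c′ × (∀ v → OnCycle k s v → c′ v ≡ c v))))
    first-hit {y = y} ε y≢z on = y , on , y≢z , λ c st → c , st , λ _ _ → refl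
    first-hit {k} {s} {y = y} (_◅_ {j = w} (yw , _ , w≢z) rs) y≢z on with on-cycle? k s y
    ... | yes on-y = y , on-y , y≢z , λ c st → c , st , λ _ _ → refl
    ... | no off-y with first-hit rs w≢z on
    ... | q , on-q , q≢z , run = q , on-q , q≢z , λ c st →
      let (c′ , st′ , eq) = run (upd c y (c w)) (stable st yw) in
      c′ , st′ , λ v on-v → trans (eq v on-v) (upd-off c _ (λ { refl → off-y on-v }))

    -- This is `period` after one turn, when the colour of `s 1` is at index k and that of
    -- `s (suc r)` at index k - 2. The parity of `k` is still unknown here.
    reflect : ∀ r {k s c} → suc (suc r) ≡ k → 1 ≤ r → Chordless k s → St (s 0) c → c (s (suc r)) ≡ c (s 1)
    reflect r {s = s} {c} refl r≥1 ch st = trans (sym (turned-< (s≤s (n≤1+n r))))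
        (trans (sym (period r (s≤s (s≤s z≤n)) (rot-chordless (s≤s z≤n) ch) turned-state r≥1 ≤-refl)) turned-k)
      where
      open Turn (s≤s z≤n) (cycle ch) st

    -- The hole leaves the cycle at s 0 through y, which moves the colour of y to s 0, and first returns at some s m.
    module Exit {k s y} (k≥4 : 4 ≤ k) (ch : Chordless k s) (zy : s 0 ~ y) (off : ¬ OnCycle k s y) where
      private
        k≥1 : 1 ≤ k
        k≥1 = ≤-trans (s≤s z≤n) k≥4
        k≥2 : 2 ≤ k
        k≥2 = ≤-trans (s≤s (s≤s z≤n)) k≥4
        k≥3 : 3 ≤ k
        k≥3 = <⇒≤ k≥4

      Returns : ℕ → Set
      Returns m = ∀ c → St (s 0) c → ∃[ c′ ] (St (s m) c′ × c′ (s 0) ≡ c y × (∀ i → 1 ≤ i → i ≤ k → c′ (s i) ≡ c (s i)))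

      returns : ∃[ m ] (1 ≤ m × m ≤ k × Returns m)
      returns with first-hit {k} {s} (biconn (s 0) y (s 1) (~-≢ zy ∘ sym) (~-≢ (step (cycle ch) k≥1) ∘ sym))
                     (~-≢ zy ∘ sym) (1 , s≤s k≥1 , refl)
      ... | q , (zero , _ , refl) , q≢z , run = contradiction refl q≢z
      ... | q , (suc m , s≤s m≤ , refl) , q≢z , run = suc m , s≤s z≤n , m≤ , λ c st →
        let (c′ , st′ , eq) = run (upd c (s 0) (c y)) (stable st zy) in
        c′ , st′ , trans (eq (s 0) (0 , s≤s z≤n , refl)) (upd-at c (s 0) _) ,
        λ i i≥1 i≤k → trans (eq (s i) (i , s≤s i≤k , refl)) (upd-off c _ (distinct (cycle ch) i≥1 i≤k ∘ sym))

      -- `period` for the cycle rotated so that the return vertex `s m` has index 0; the choice of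
      -- `r` decides which two vertices are compared.
      relation : ∀ {m c} → 1 ≤ m → m ≤ k → Returns m → St (s 0) c → ∀ r → 1 ≤ r → suc (suc r) ≤ k →
        ∃[ c′ ] (c′ (rotN k m s (suc (suc r))) ≡ c′ (rotN k m s r) × c′ (s 0) ≡ c y ×
                 (∀ i → 1 ≤ i → i ≤ k → c′ (s i) ≡ c (s i)))
      relation {m} {c} m≥1 m≤k ret st r r≥1 le with ret c st
      ... | c′ , st′ , at-0 , rest = c′ , period r k≥2 (rotN-chordless m k≥1 ch)
        (subst (λ v → St v c′) (sym (rotN-≤ m s m≤k)) st′) r≥1 le , at-0 , rest

      equal : ∀ {c} → St (s 0) c → c (s 1) ≡ c (s 2)
      equal {c} st with returns
      -- Return at `s 1`: comparing `s 0` with `s (suc r)`, the vertex before `s k`, gives `y` the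
      -- colour of `s 1` in every state with the hole at `s 0`. A full turn keeps the colour of `y`
      -- and puts that of `s 2` at `s 1`.
      ... | suc zero , m≥1 , m≤k , ret = trans (sym (forced st)) (trans (sym (fixed y (λ j le eq → off (j , s≤s le , sym eq))))
              (trans (forced st′) (moved 1 k≥2)))
        where
        rotated = rotate k≥1 (cycle ch) st
        st′ = proj₁ (proj₂ rotated)
        moved = proj₁ (proj₂ (proj₂ rotated))
        fixed = proj₂ (proj₂ (proj₂ (proj₂ rotated)))
        r = k ∸ 2
        r≥1 : 1 ≤ r
        r≥1 = m<n⇒0<n∸m k≥3
        r+2 : suc (suc r) ≡ k
        r+2 = trans (+-comm 2 r) (m∸n+n≡m k≥2)
        forced : ∀ {c} → St (s 0) c → c y ≡ c (s 1)
        forced {c} st with relation m≥1 m≤k ret st r r≥1 (≤-reflexive r+2)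
        ... | c′ , eq , at-0 , rest = trans (sym at-0) (trans
          (cong c′ (sym (rotN-wrap 1 s {suc (suc r)} {0} (trans (+-comm _ 1) (cong suc (trans r+2 (sym (+-identityʳ k))))) (≤-reflexive r+2) z≤n)))
          (trans eq (trans (cong c′ (trans (rotN-≤ 1 s {r} (≤-trans (≤-reflexive (+-comm r 1)) r<k)) (cong s (+-comm r 1))))
          (trans (rest (suc r) (s≤s z≤n) r<k) (reflect r r+2 r≥1 ch st)))))
          where
          r<k : suc r ≤ k
          r<k = ≤-trans (n≤1+n (suc r)) (≤-reflexive r+2)
      ... | suc (suc m) , m≥1 , m≤k , ret with m≤n⇒m<n∨m≡n m≤k
      -- Return at `s m′` with 2 ≤ m′ < k: the indices `r` and r + 2 belong to `s k` and `s 1`, on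
      -- either side of `s 0`; `alternate` then replaces `s k` by `s 2`.
      ... | inj₁ m<k = interior
        where
        m′ = suc (suc m)
        r = k ∸ m′
        r+m : r + m′ ≡ k
        r+m = m∸n+n≡m m≤k
        interior : c (s 1) ≡ c (s 2)
        interior with relation m≥1 m≤k ret st r (m<n⇒0<n∸m m<k)
                        (≤-trans (≤-trans (≤-reflexive (+-comm 2 r)) (+-monoʳ-≤ r (s≤s (s≤s z≤n)))) (≤-reflexive r+m))
        ... | c′ , eq , at-0 , rest = trans (sym (rest 1 ≤-refl k≥1)) (trans
          (cong c′ (sym (rotN-wrap m′ s {j = 1} (trans (cong (λ x → suc (suc x)) r+m) (cong suc (+-comm 1 k)))
             (≤-trans (≤-trans (≤-reflexive (+-comm 2 r)) (+-monoʳ-≤ r (s≤s (s≤s z≤n)))) (≤-reflexive r+m)) k≥1)))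
          (trans eq (trans (cong c′ (trans (rotN-≤ m′ s (≤-reflexive r+m)) (cong s r+m)))
          (trans (rest k k≥1 ≤-refl) (sym (alternate k≥2 (cycle ch) (no-chord₀ ch) st))))))
      -- Return at `s k`: comparing `s 0` with `s 2` gives `y` the colour of `s 2`. A full turn puts
      -- the colour of `s 3`, which by `period` is that of `s 1`, at `s 2`.
      ... | inj₂ m≡k = trans (sym (period 1 k≥2 ch st ≤-refl k≥3)) (trans (trans (sym (moved 2 k≥3)) (trans (sym (forced st′))
              (fixed y (λ j le eq → off (j , s≤s le , sym eq))))) (forced st))
        where
        rotated = rotate k≥1 (cycle ch) st
        st′ = proj₁ (proj₂ rotated)
        moved = proj₁ (proj₂ (proj₂ rotated))
        fixed = proj₂ (proj₂ (proj₂ (proj₂ rotated)))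
        forced : ∀ {c} → St (s 0) c → c y ≡ c (s 2)
        forced {c} st with relation m≥1 m≤k ret st 1 ≤-refl k≥3
        ... | c′ , eq , at-0 , rest = trans (sym at-0) (trans
          (cong c′ (sym (rotN-wrap (suc (suc m)) s {1} {0} (trans (cong suc m≡k) (cong suc (sym (+-identityʳ k)))) k≥1 z≤n)))
          (trans (sym eq) (trans
          (cong c′ (rotN-wrap (suc (suc m)) s {3} {2} (cong suc (trans (cong (λ x → suc (suc x)) m≡k) (+-comm 2 k))) k≥3 k≥2))
          (rest 2 (s≤s z≤n) k≥2))))

    all-equal : ∀ {k s c} → 2 ≤ k → Chordless k s → St (s 0) c → c (s 1) ≡ c (s 2) →
      ∀ i → 1 ≤ i → i ≤ k → c (s i) ≡ c (s 1)
    all-equal k≥2 ch st eq (suc zero) _ _ = refl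
    all-equal k≥2 ch st eq (suc (suc zero)) _ _ = sym eq
    all-equal k≥2 ch st eq (suc (suc (suc i))) _ le =
      trans (period (suc i) k≥2 ch st (s≤s z≤n) le) (all-equal k≥2 ch st eq (suc i) (s≤s z≤n) (<⇒≤ (<⇒≤ le)))

    -- Rotation reduces to j = 0. There a neighbour off the cycle would, by `Exit.equal` and
    -- `period`, make the cycle constant in every state with the hole at `s 0`.
    cycle-closed : ∀ j {k s y} → 4 ≤ k → Chordless k s → j ≤ k → s j ~ y → OnCycle k s y
    cycle-closed zero {k} {s} {y} k≥4 ch _ adj with on-cycle? k s y
    ... | yes on = on
    ... | no off = ⊥-elim (constant-cycle k≥2 (cycle ch) (λ st i≥1 i≤ j≥1 j≤ →
        trans (all-equal k≥2 ch st (Exit.equal k≥4 ch adj off st) _ i≥1 i≤)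
         (sym (all-equal k≥2 ch st (Exit.equal k≥4 ch adj off st) _ j≥1 j≤))))
      where
      k≥2 = ≤-trans (s≤s (s≤s z≤n)) k≥4
    cycle-closed (suc j) {k} {s} {y} k≥4 ch j<k adj =
      on-cycle-rot (cycle-closed j k≥4 (rot-chordless (≤-trans (s≤s z≤n) k≥4) ch) (<⇒≤ j<k) (subst (_~ y) (sym (rot-< s j<k)) adj))

    cycle-spans : ∀ {k s} → 4 ≤ k → Chordless k s → ∀ v → OnCycle k s v
    cycle-spans {k} {s} k≥4 ch v = along (conn (s 0) v) (0 , s≤s z≤n , refl)
      where
      along : ∀ {u v} → Star _~_ u v → OnCycle k s u → OnCycle k s v
      along ε on = on
      along (adj ◅ rs) (j , lt , refl) = along rs (cycle-closed j k≥4 ch (≤-pred lt) adj)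

    unequal : ∀ {k s c} → 4 ≤ k → Chordless k s → St (s 0) c → c (s 1) ≢ c (s 2)
    unequal {k} {s} {c} k≥4 ch st eq with nonmono st
    ... | u , w , u≢z , w≢z , neq = neq (trans (to-1 u u≢z) (sym (to-1 w w≢z)))
      where
      to-1 : ∀ v → v ≢ s 0 → c v ≡ c (s 1)
      to-1 v v≢z with cycle-spans k≥4 ch v
      ... | zero , _ , refl = contradiction refl v≢z
      ... | suc i , s≤s le , refl = all-equal (≤-trans (s≤s (s≤s z≤n)) k≥4) ch st eq (suc i) (s≤s z≤n) le

    ends-differ : ∀ {k s c} → 4 ≤ k → Chordless k s → St (s 0) c → c (s 1) ≢ c (s k)
    ends-differ k≥4 ch st eq = unequal k≥4 ch st (trans eq
      (sym (alternate (≤-trans (s≤s (s≤s z≤n)) k≥4) (cycle ch) (no-chord₀ ch) st)))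

    -- For odd `k`, steps of two lead from `s 1` to `s k`, whose colours differ. Thus the number k +
    -- 1 of vertices is odd.
    even : ∀ {k s c} → 4 ≤ k → Chordless k s → St (s 0) c → ∃[ q ] k ≡ 2 * q
    even {k} {s} {c} k≥4 ch st = by-parity (parity k)
      where
      parity : ∀ k → ∃[ q ] (k ≡ 2 * q ⊎ k ≡ suc (2 * q))
      parity zero = 0 , inj₁ refl
      parity (suc k) with parity k
      ... | q , inj₁ refl = q , inj₂ refl
      ... | q , inj₂ refl = suc q , inj₁ (sym (*-suc 2 q))
      odd : ∀ q → suc (2 * q) ≤ k → c (s (suc (2 * q))) ≡ c (s 1)
      odd zero _ = refl
      odd (suc q) le rewrite *-suc 2 q = trans (period (suc (2 * q)) (≤-trans (s≤s (s≤s z≤n)) k≥4) ch st (s≤s z≤n) le)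
        (odd q (<⇒≤ (<⇒≤ le)))
      by-parity : (∃[ q ] (k ≡ 2 * q ⊎ k ≡ suc (2 * q))) → ∃[ q ] k ≡ 2 * q
      by-parity (q , inj₁ eq) = q , eq
      by-parity (q , inj₂ eq) = contradiction (sym (subst (λ x → c (s x) ≡ c (s 1)) (sym eq) (odd q (≤-reflexive (sym eq)))))
        (ends-differ k≥4 ch st)

    turn-weight : ∀ {k s c} → 4 ≤ k → Chordless k s → St (s 0) c → m (rot k s 0) (rot k s 1) ≡ m (s 0) (s 1)
    turn-weight {k} {s} k≥4 ch st = trans (uniform k≥2 (cycle ch′) (no-chord₀ ch′) turned-state
        (ends-differ k≥4 ch′ turned-state)) (trans (cong₂ m (rot-< s k≥1) (rot-k k s)) (m-sym _ _))
      where
      k≥2 = ≤-trans (s≤s (s≤s z≤n)) k≥4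
      k≥1 = <⇒≤ k≥2
      ch′ = rot-chordless k≥1 ch
      open Turn k≥1 (cycle ch) st

    weight : ∀ r {k s c} → 4 ≤ k → Chordless k s → St (s 0) c → r < k → m (s r) (s (suc r)) ≡ m (s 0) (s 1)
    weight zero k≥4 ch st _ = refl
    weight (suc r) {k} {s} k≥4 ch st r<k = trans (sym (cong₂ m (rot-< s (<⇒≤ r<k)) (rot-< s r<k)))
        (trans (weight r k≥4 (rot-chordless k≥1 ch) turned-state (<⇒≤ r<k)) (turn-weight k≥4 ch st))
      where
      k≥1 = ≤-trans (s≤s z≤n) k≥4
      open Turn k≥1 (cycle ch) st

    weight-close : ∀ {k s c} → 4 ≤ k → Chordless k s → St (s 0) c → m (s k) (s 0) ≡ m (s 0) (s 1)
    weight-close k≥4 ch st = trans (m-sym _ _)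
      (sym (uniform (≤-trans (s≤s (s≤s z≤n)) k≥4) (cycle ch) (no-chord₀ ch) st (ends-differ k≥4 ch st)))

    -- The hole sees only its two neighbours on the cycle, with equal weights. A turn exchanges the
    -- two colours seen, and the sum is symmetric in them.
    f-on-cycle : ∀ r {k s c} → 4 ≤ k → Chordless k s → St (s 0) c → r ≤ k → ∀ i →
      f (s r) i ≡ m (s 0) (s 1) * (ind (does (c (s 1) ≟ i)) + ind (does (c (s k) ≟ i)))
    f-on-cycle zero {k} {s} {c} k≥4 ch st _ i = begin
      f (s 0) i         ≡⟨ f-sum st i ⟩
      sumFin g          ≡⟨ sum-double g (s 1) (s k) (distinct (cycle ch) k≥2 ≤-refl) off ⟩
      g (s 1) + g (s k) ≡⟨ cong (λ x → g (s 1) + x * ind (does (c (s k) ≟ i))) (trans (m-sym _ _) (weight-close k≥4 ch st)) ⟩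
      m (s 0) (s 1) * ind (does (c (s 1) ≟ i)) + m (s 0) (s 1) * ind (does (c (s k) ≟ i))
                        ≡⟨ sym (*-distribˡ-+ (m (s 0) (s 1)) _ _) ⟩
      _                 ∎
      where
      open ≡-Reasoning
      k≥2 = ≤-trans (s≤s (s≤s z≤n)) k≥4
      g : V → ℕ
      g u = m (s 0) u * ind (does (c u ≟ i))
      off : ∀ u → u ≢ s 1 → u ≢ s k → g u ≡ 0
      off u u≢1 u≢k = cong (_* ind (does (c u ≟ i))) (m-zero (non (cycle-spans k≥4 ch u)))
        where
        non : OnCycle k s u → ¬ s 0 ~ u
        non (zero , _ , refl) a = ~-≢ a refl
        non (suc zero , _ , refl) _ = u≢1 refl
        non (suc (suc j) , s≤s le , refl) with m≤n⇒m<n∨m≡n le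
        ... | inj₁ lt = no-chord₀ ch (s≤s (s≤s z≤n)) lt
        ... | inj₂ refl = λ _ → u≢k refl
    f-on-cycle (suc r) {k} {s} {c} k≥4 ch st r<k i = begin
      f (s (suc r)) i ≡⟨ cong (λ v → f v i) (sym (rot-< s r<k)) ⟩
      f (rot k s r) i ≡⟨ f-on-cycle r k≥4 (rot-chordless k≥1 ch) turned-state (<⇒≤ r<k) i ⟩
      m (rot k s 0) (rot k s 1) * (χ (turned (rot k s 1)) + χ (turned (rot k s k)))
                      ≡⟨ cong₂ _*_ (turn-weight k≥4 ch st) (trans (cong₂ (λ x y → χ x + χ y)
                           (trans (turned-< k≥2) (alternate k≥2 (cycle ch) (no-chord₀ ch) st)) turned-k) (+-comm (χ (c (s k))) _)) ⟩
      m (s 0) (s 1) * (χ (c (s 1)) + χ (c (s k))) ∎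
      where
      open ≡-Reasoning
      k≥2 = ≤-trans (s≤s (s≤s z≤n)) k≥4
      k≥1 = <⇒≤ k≥2
      χ : Fin p → ℕ
      χ x = ind (does (x ≟ i))
      open Turn k≥1 (cycle ch) st

    -- Take an induced path from `x` to `y` in H - z, with second vertex `w`. If `z` is not adjacent
    -- to `w`, the cycle runs from `z` through `x` and `w` to the next neighbour of `z`. Otherwise
    -- it starts with `w` in place of `x`; the vertex after `w` is not adjacent to `z`, by `quad`.
    -- Finally `quad` excludes length four.
    long-cycle : ∀ {x z y} → x ≢ y → ¬ x ~ y → x ~ z → z ~ y → ∃[ k ] ∃[ s ] (4 ≤ k × Chordless k s)
    long-cycle {x} {z} {y} x≢y x≁y xz zy with induced-path (biconn z x y (~-≢ xz) (~-≢ zy ∘ sym))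
    ... | [] , _ , refl , _ = contradiction refl x≢y
    ... | w ∷ l , (xw , far , pth) , refl , (w≢z ∷ avoid) = lengthen (shape (z ~? w))
      where
      lengthen : ∃[ k ] ∃[ s ] (3 ≤ k × Chordless k s) → ∃[ k ] ∃[ s ] (4 ≤ k × Chordless k s)
      lengthen (k , s , k≥3 , ch) with m≤n⇒m<n∨m≡n k≥3
      ... | inj₁ k≥4 = k , s , k≥4 , ch
      ... | inj₂ refl = ⊥-elim (quad (distinct cy {0} {2} (s≤s z≤n) (s≤s (s≤s z≤n))) (no-chord₀ ch ≤-refl ≤-refl)
          (distinct cy {1} {3} (s≤s (s≤s z≤n)) ≤-refl)
          (step cy (s≤s z≤n)) (step cy (s≤s (s≤s z≤n))) (step cy ≤-refl) (close cy))
        where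
        cy = cycle ch
      shape : Dec (z ~ w) → ∃[ k ] ∃[ s ] (3 ≤ k × Chordless k s)
      shape (no z≁w) with truncate l pth zy
      ... | l′ , pth′ , zl′ , inner , sub =
        close-path (xw , sub far , pth′) (~-sym xz) z≁w zl′ inner (~-≢ xz) (w≢z ∷ sub avoid)
      shape (yes zw) = beyond l far pth avoid zy x≁y
        where
        beyond : ∀ l → All (λ v → x ≢ v × ¬ x ~ v) l → Path w l → All (_≢ z) l → z ~ end w l → ¬ x ~ end w l →
          ∃[ k ] ∃[ s ] (3 ≤ k × Chordless k s)
        beyond [] _ _ _ _ x≁w = contradiction xw x≁w
        beyond (w₂ ∷ l) ((x≢w₂ , x≁w₂) ∷ _) (ww₂ , far , pth) (w₂≢z ∷ avoid) zl _ with z ~? w₂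
        ... | yes zw₂ = ⊥-elim (quad x≢w₂ x≁w₂ (w≢z ∘ sym) xz zw₂ (~-sym ww₂) (~-sym xw))
        ... | no z≁w₂ with truncate l pth zl
        ... | l′ , pth′ , zl′ , inner , sub =
          close-path (ww₂ , sub far , pth′) zw z≁w₂ zl′ inner w≢z (w₂≢z ∷ sub avoid)

-- Splitting at a separating vertex

sum-colour-∧ : ∀ {p} a b (x : Fin p) → ind (a ∧ b) ≡ sumFin (λ i → ind (a ∧ (b ∧ does (x ≟ i))))
sum-colour-∧ true  true  x = sym (sum-colour x)
sum-colour-∧ {p} true false x = sym (sum-0 {p})
sum-colour-∧ {p} false _    x = sym (sum-0 {p})

-- One side of `v`; the other is the same module with the roles exchanged. Hence `F̄` is a parameter
-- tied to `F` by `F̄-not`.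
module Half (H : Hypergraph) {p : ℕ} (f : VFun p H) (conn : Connected H)
  (d≤ : ∀ v → deg H v ≤ sumFin (f v)) (np : ¬ Partitionable H f)
  (v : Fin (nv H)) (c : Fin (nv H) → Fin p) (st : Colouring.State H f v c)
  (X₁ X₂ : VSet H) (F F̄ : Fin (ne H) → Bool)
  (inter : ∀ u → (X₁ u ≡ true × X₂ u ≡ true) → u ≡ v) (X₁v : X₁ v ≡ true) (X₂≥2 : 2 ≤ count X₂)
  (F⊆ : ∀ e → F e ≡ true → EdgeIn H X₁ e) (F̄⊆ : ∀ e → F̄ e ≡ true → EdgeIn H X₂ e)
  (F̄-not : ∀ e → F̄ e ≡ not (F e)) where

  open Colouring H f
  open Tight d≤ np

  vertices = listing X₁
  edges = listing F

  private
    V = Fin (nv H)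
    V₁ = Fin (size vertices)
    E₁ = Fin (size edges)
    el = elem vertices
    ee = elem edges

  F-or-F̄ : ∀ e → F e ≡ true ⊎ (F e ≡ false × F̄ e ≡ true)
  F-or-F̄ e with F e | F̄-not e
  ... | true  | _  = inj₁ refl
  ... | false | eq = inj₂ (refl , eq)

  part : Hypergraph
  part = record { nv = size vertices ; ne = size edges ; inc = λ e u → inc H (ee e) (el u) ; inc-≥2 = two }
    where
    two : ∀ e → 2 ≤ count (λ u → inc H (ee e) (el u))
    two e = ≤-trans (inc-≥2 H (ee e)) (≤-reflexive (trans (sum-cong pt) (sym (sum-elem vertices (λ w → ind (inc H (ee e) w))))))
      where
      pt : ∀ w → ind (inc H (ee e) w) ≡ (if X₁ w then ind (inc H (ee e) w) else 0)
      pt w with X₁ w in eq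
      ... | true = refl
      ... | false = ind-false (λ h → true≢false (F⊆ (ee e) (sound edges e) w h) eq)

  at-v : Fin p → Fin (ne H) → Bool
  at-v i e = inc H e v ∧ does (c (other H v e) ≟ i)

  -- At `v`, the edges of this side are counted by their colours in the given state; by `f-split`
  -- the two sides share out `f v`.
  f₁ : VFun p part
  f₁ u i = if does (el u ≟ v) then count (λ e → F e ∧ at-v i e) else f (el u) i

  f₁-v : ∀ {u} i → el u ≡ v → f₁ u i ≡ count (λ e → F e ∧ at-v i e)
  f₁-v {u} i eq rewrite dec-true (el u ≟ v) eq = refl

  f₁-≢v : ∀ {u} i → el u ≢ v → f₁ u i ≡ f (el u) i
  f₁-≢v {u} i neq rewrite dec-false (el u ≟ v) neq = refl

  f-split : ∀ i → f v i ≡ count (λ e → F e ∧ at-v i e) + count (λ e → F̄ e ∧ at-v i e)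
  f-split i = trans (f-count st i) (trans (sum-cong pt)
      (sum-+ (λ e → ind (F e ∧ at-v i e)) (λ e → ind (F̄ e ∧ at-v i e))))
    where
    pt : ∀ e → ind (at-v i e) ≡ ind (F e ∧ at-v i e) + ind (F̄ e ∧ at-v i e)
    pt e rewrite F̄-not e with F e
    ... | true  = sym (+-identityʳ _)
    ... | false = refl

  smaller : nv part < nv H
  smaller with count≥2⇒ X₂ X₂≥2 v
  ... | w , X₂w , w≢v = subst₂ _<_ (trans (sym (sum-elem vertices (λ _ → 1))) sum-1) sum-1
      (count-mono-< {b = X₁} {d = full} (λ _ _ → refl) w (not-true (λ h → w≢v (inter w (h , X₂w)))) refl)

  deg-part : ∀ u → deg part u ≡ count (λ e → F e ∧ inc H e (el u))
  deg-part u = trans (sum-elem edges (λ e → ind (inc H e (el u)))) (sum-cong pt)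
    where
    pt : ∀ e → (if F e then ind (inc H e (el u)) else 0) ≡ ind (F e ∧ inc H e (el u))
    pt e with F e
    ... | true  = refl
    ... | false = refl

  d₁≤ : ∀ u → deg part u ≤ sumFin (f₁ u)
  d₁≤ u with el u ≟ v
  ... | yes eq = ≤-reflexive (trans (deg-part u) (trans (sum-cong pt)
      (sym (sum-swap (λ i e → ind (F e ∧ at-v i e))))))
    where
    pt : ∀ e → ind (F e ∧ inc H e (el u)) ≡ count (λ i → F e ∧ at-v i e)
    pt e rewrite eq = sum-colour-∧ (F e) (inc H e v) (c (other H v e))
  ... | no neq = ≤-trans (≤-reflexive (deg-part u))
      (≤-trans (count-mono (λ e h → ∧-trueʳ {F e} h)) (d≤ (el u)))

  glue : (V₁ → Fin p) → V → Fin p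
  glue c₁ w with X₁ w ≟ᵇ true
  ... | yes h = c₁ (index vertices w h)
  ... | no _  = c w

  glue-on : ∀ c₁ u → glue c₁ (el u) ≡ c₁ u
  glue-on c₁ u with X₁ (el u) ≟ᵇ true
  ... | yes h = cong c₁ (inj vertices (elem-index vertices (el u) h))
  ... | no ¬h = contradiction (sound vertices u) ¬h

  glue-off : ∀ c₁ {w} → ¬ X₁ w ≡ true → glue c₁ w ≡ c w
  glue-off c₁ {w} ¬h with X₁ w ≟ᵇ true
  ... | yes h = contradiction h ¬h
  ... | no _  = refl

  -- A partition of this side, completed by `c`, would partition `H`. Test sets missing `X₁` are
  -- settled by the state. For the others this side supplies a vertex of small degree; if it is `v`,
  -- its further edges lie in `X₂`, coloured by `c`, and the other share of `f v` pays for them.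
  np₁ : ¬ Partitionable part f₁
  np₁ (c₁ , sd) = np (good⇒partitionable {c = glue c₁} good)
    where
    good : Good full (glue c₁)
    good X i _ mono some with any? (λ u → X (el u) ≟ᵇ true)
    ... | no none = st X i (λ w Xw → ∖-intro full {v} {w} refl (λ { refl → off w Xw X₁v }))
        (λ w Xw → trans (sym (glue-off c₁ (off w Xw))) (mono w Xw)) some
      where
      off : ∀ w → X w ≡ true → ¬ X₁ w ≡ true
      off w Xw h = none (index vertices w h , trans (cong X (elem-index vertices w h)) Xw)
    ... | yes (u₀ , Xu₀) with sd i (λ u → X (el u)) (λ e → inside H X (ee e))
          (λ u Xu → dec-true (c₁ u ≟ i) (trans (sym (glue-on c₁ u)) (mono (el u) Xu)))
          (λ e h u eu → does⇒ (edgeIn? H X (ee e)) h (el u) eu) (u₀ , Xu₀)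
    ... | u , Xu , lt = el u , Xu , bound (el u ≟ v)
      where
      D : Fin (ne H) → ℕ
      D e = if F e then ind (inside H X e ∧ inc H e (el u)) else 0
      lt′ : sumFin D < f₁ u i
      lt′ = subst (_< f₁ u i) (sum-elem edges (λ e → ind (inside H X e ∧ inc H e (el u)))) lt
      bound : Dec (el u ≡ v) → degSub H (inside H X) (el u) < f (el u) i
      bound (no neq) = ≤-<-trans (sum-mono pt) (<-≤-trans lt′ (≤-reflexive (f₁-≢v i neq)))
        where
        pt : ∀ e → ind (inside H X e ∧ inc H e (el u)) ≤ D e
        pt e with F-or-F̄ e
        ... | inj₁ Fe rewrite Fe = ≤-refl
        ... | inj₂ (_ , F̄e) = ≤-trans (≤-reflexive (ind-false (λ h →
          neq (inter (el u) (sound vertices u , F̄⊆ e F̄e (el u) (∧-trueʳ {inside H X e} h)))))) z≤n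
      bound (yes eq) = begin-strict
        degSub H (inside H X) (el u)                  ≤⟨ sum-mono pt ⟩
        sumFin (λ e → D e + ind (F̄ e ∧ at-v i e))     ≡⟨ sum-+ D _ ⟩
        sumFin D + count (λ e → F̄ e ∧ at-v i e)       <⟨ +-monoˡ-< _ lt′ ⟩
        f₁ u i + count (λ e → F̄ e ∧ at-v i e)         ≡⟨ cong (_+ _) (f₁-v i eq) ⟩
        count (λ e → F e ∧ at-v i e) + count (λ e → F̄ e ∧ at-v i e) ≡⟨ sym (f-split i) ⟩
        f v i                                         ≡⟨ cong (λ w → f w i) (sym eq) ⟩
        f (el u) i                                    ∎
        where
        open ≤-Reasoning
        pt : ∀ e → ind (inside H X e ∧ inc H e (el u)) ≤ D e + ind (F̄ e ∧ at-v i e)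
        pt e with F-or-F̄ e
        ... | inj₁ Fe rewrite Fe = m≤m+n _ _
        ... | inj₂ (_ , F̄e) = ≤-trans (ind-mono imp) (m≤n+m _ (D e))
          where
          o = other H v e
          imp : inside H X e ∧ inc H e (el u) ≡ true → F̄ e ∧ at-v i e ≡ true
          imp h = ∧-true F̄e (∧-true (subst (λ w → inc H e w ≡ true) eq (∧-trueʳ {inside H X e} h))
            (dec-true (c o ≟ i) (trans (sym (glue-off c₁ (λ X₁o →
              other-≢ H v e (inter o (X₁o , F̄⊆ e F̄e o (other-∈ H v e))))))
              (mono o (does⇒ (edgeIn? H X e) (∧-trueˡ {inside H X e} h) o (other-∈ H v e))))))

  connected₁ : Connected part
  connected₁ = nonempty v₁ , crossing
    where
    v₁ : V₁
    v₁ = index vertices v X₁v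
    nonempty : ∀ {n} → Fin n → 1 ≤ n
    nonempty zero    = s≤s z≤n
    nonempty (suc _) = s≤s z≤n
    crossing : (Y : VSet part) → (∃[ u ] Y u ≡ true) → (∃[ u ] Y u ≡ false) →
      ∃[ e ] ∃[ u ] ∃[ w ] (inc part e u ≡ true × Y u ≡ true × inc part e w ≡ true × Y w ≡ false)
    crossing Y (u , Yu) (w , Yw) = cross
      where
      -- Y is extended to V(H) by giving the vertices outside X₁ the status of v.
      Y⁺ : VSet H
      Y⁺ a with X₁ a ≟ᵇ true
      ... | yes h = Y (index vertices a h)
      ... | no _  = Y v₁
      Y⁺-el : ∀ u → Y⁺ (el u) ≡ Y u
      Y⁺-el u with X₁ (el u) ≟ᵇ true
      ... | yes h = cong Y (inj vertices (elem-index vertices (el u) h))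
      ... | no ¬h = contradiction (sound vertices u) ¬h
      Y⁺-X₂ : ∀ a → X₂ a ≡ true → Y⁺ a ≡ Y v₁
      Y⁺-X₂ a X₂a with X₁ a ≟ᵇ true
      ... | yes h = cong Y (inj vertices (trans (elem-index vertices a h)
        (trans (inter a (h , X₂a)) (sym (elem-index vertices v X₁v)))))
      ... | no _ = refl
      cross : ∃[ e ] ∃[ u ] ∃[ w ] (inc part e u ≡ true × Y u ≡ true × inc part e w ≡ true × Y w ≡ false)
      cross with proj₂ conn Y⁺ (el u , trans (Y⁺-el u) Yu) (el w , trans (Y⁺-el w) Yw)
      ... | e , a , b , ea , Ya , eb , Yb with F-or-F̄ e
      -- An edge of `F̄` lies in `X₂`, where `Y⁺` is constant, so it cannot cross.
      ... | inj₂ (_ , F̄e) = ⊥-elim (true≢false (trans (sym (Y⁺-X₂ a (F̄⊆ e F̄e a ea))) Ya)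
                                              (trans (sym (Y⁺-X₂ b (F̄⊆ e F̄e b eb))) Yb))
      ... | inj₁ Fe = index edges e Fe , a₁ , b₁
          , subst₂ (λ e a → inc H e a ≡ true) (sym (elem-index edges e Fe)) (sym ela) ea
          , trans (sym (Y⁺-el a₁)) (trans (cong Y⁺ ela) Ya)
          , subst₂ (λ e a → inc H e a ≡ true) (sym (elem-index edges e Fe)) (sym elb) eb
          , trans (sym (Y⁺-el b₁)) (trans (cong Y⁺ elb) Yb)
        where
        a₁ = index vertices a (F⊆ e Fe a ea)
        b₁ = index vertices b (F⊆ e Fe b eb)
        ela = elem-index vertices a (F⊆ e Fe a ea)
        elb = elem-index vertices b (F⊆ e Fe b eb)

merge : ∀ {p} (H : Hypergraph) (f : VFun p H) → Connected H → Fin p →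
  (∀ v → deg H v ≤ sumFin (f v)) → ¬ Partitionable H f → ∃ (Separating H) →
  ((H′ : Hypergraph) (f′ : VFun p H′) → nv H′ < nv H → Connected H′ →
    (∀ v → deg H′ v ≤ sumFin (f′ v)) → ¬ Partitionable H′ f′ → Hard H′ f′) → Hard H f
merge H f conn i₀ d≤ np (v , X₁ , X₂ , cover , inter , X₁v , X₂v , X₁≥2 , X₂≥2 , edge) IH =
  hardMerge H f A.part A.f₁ B.part B.f₁
    (IH A.part A.f₁ A.smaller A.connected₁ A.d₁≤ A.np₁)
    (IH B.part B.f₁ B.smaller B.connected₁ B.d₁≤ B.np₁)
    v¹ v² (elem A.vertices) (elem B.vertices) (inj A.vertices) (inj B.vertices)
    cover′ (trans el¹ (sym el²))
    (λ u₁ u₂ eq → inj A.vertices (trans (inter _ (sound A.vertices u₁ , trans (cong X₂ eq) (sound B.vertices u₂))) (sym el¹)))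
    (mk↔ₛ′ to from to-from from-to)
    (λ _ _ → refl) (λ e u h → index A.vertices u (F⊆ _ (sound A.edges e) u h) , elem-index A.vertices u _)
    (λ _ _ → refl) (λ e u h → index B.vertices u (F̄⊆ _ (sound B.edges e) u h) , elem-index B.vertices u _)
    (λ u i u≢ → sym (A.f₁-≢v i (λ eq → u≢ (inj A.vertices (trans eq (sym el¹))))))
    (λ u i u≢ → sym (B.f₁-≢v i (λ eq → u≢ (inj B.vertices (trans eq (sym el²))))))
    (λ i → trans (cong (λ w → f w i) el¹) (trans (A.f-split i) (sym (cong₂ _+_ (A.f₁-v i el¹) (B.f₁-v i el²)))))
  where
  F F̄ : Fin (ne H) → Bool
  F = inside H X₁
  F̄ e = not (F e)
  F⊆ : ∀ e → F e ≡ true → EdgeIn H X₁ e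
  F⊆ e = does⇒ (edgeIn? H X₁ e)
  F̄⊆ : ∀ e → F̄ e ≡ true → EdgeIn H X₂ e
  F̄⊆ e h with edge e
  ... | inj₂ h₂ = h₂
  ... | inj₁ h₁ = contradiction (trans (sym (cong not (dec-true (edgeIn? H X₁ e) h₁))) h) (λ ())
  -- The same state serves both sides, which makes the two shares add up to `f v`.
  state = Colouring.state-exists H f conn d≤ i₀ v
  inter′ : ∀ u → (X₂ u ≡ true × X₁ u ≡ true) → u ≡ v
  inter′ u (h₂ , h₁) = inter u (h₁ , h₂)
  F-not : ∀ e → F e ≡ not (F̄ e)
  F-not e with F e
  ... | true  = refl
  ... | false = refl
  module A = Half H f conn d≤ np v (proj₁ state) (proj₂ state) X₁ X₂ F F̄ inter X₁v X₂≥2 F⊆ F̄⊆ (λ _ → refl)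
  module B = Half H f conn d≤ np v (proj₁ state) (proj₂ state) X₂ X₁ F̄ F
    inter′ X₂v X₁≥2 F̄⊆ F⊆ F-not
  v¹ = index A.vertices v X₁v
  v² = index B.vertices v X₂v
  el¹ : elem A.vertices v¹ ≡ v
  el¹ = elem-index A.vertices v X₁v
  el² : elem B.vertices v² ≡ v
  el² = elem-index B.vertices v X₂v
  cover′ : ∀ u → (∃[ w ] elem A.vertices w ≡ u) ⊎ (∃[ w ] elem B.vertices w ≡ u)
  cover′ u with cover u
  ... | inj₁ h = inj₁ (index A.vertices u h , elem-index A.vertices u h)
  ... | inj₂ h = inj₂ (index B.vertices u h , elem-index B.vertices u h)
  to : Fin (ne H) → Fin (size A.edges) ⊎ Fin (size B.edges)
  to e with F e ≟ᵇ true
  ... | yes h = inj₁ (index A.edges e h)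
  ... | no ¬h = inj₂ (index B.edges e (cong not (not-true ¬h)))
  from : Fin (size A.edges) ⊎ Fin (size B.edges) → Fin (ne H)
  from = [ elem A.edges , elem B.edges ]′
  to-from : ∀ x → to (from x) ≡ x
  to-from (inj₁ e) with F (elem A.edges e) ≟ᵇ true
  ... | yes h = cong inj₁ (inj A.edges (elem-index A.edges _ h))
  ... | no ¬h = contradiction (sound A.edges e) ¬h
  to-from (inj₂ e) with F (elem B.edges e) ≟ᵇ true
  ... | yes h = contradiction (trans (sym (cong not h)) (sound B.edges e)) (λ ())
  ... | no ¬h = cong inj₂ (inj B.edges (elem-index B.edges _ _))
  from-to : ∀ e → from (to e) ≡ e
  from-to e with F e ≟ᵇ true
  ... | yes h = elem-index A.edges e h
  ... | no ¬h = elem-index B.edges e _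

-- Blocks

module Block (H : Hypergraph) {p : ℕ} (f : VFun p H) (conn : Connected H) (i₀ : Fin p)
  (d≤ : ∀ v → deg H v ≤ sumFin (f v)) (np : ¬ Partitionable H f)
  (walk : ∀ w u v → u ≢ w → v ≢ w → Star (Avoid H w) u v) where

  open Colouring H f
  open Tight d≤ np

  private
    V = Fin (nv H)

  open Graph (Adj H)

  conn* : ∀ u v → Star (Adj H) u v
  conn* = connected⇒walk H conn

  -- One colour off the hole: case (M)

  module Monochromatic (j : Fin p) (z₀ : V) (c₀ : V → Fin p) (st₀ : State z₀ c₀) (all-j : ∀ u → u ≢ z₀ → c₀ u ≡ j) where

    MonoState : V → (V → Fin p) → Set
    MonoState z c = State z c × (∀ u → u ≢ z → c u ≡ j)

    mono-stable : Stable MonoState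
    mono-stable {z} {c} {u} (st , all) adj = move st adj , all′
      where
      all′ : ∀ w → w ≢ u → upd c z (c u) w ≡ j
      all′ w _ with w ≟ z
      ... | yes _ = all u (proj₁ adj ∘ sym)
      ... | no w≢z = all w w≢z

    mono-at : ∀ v → ∃ (MonoState v)
    mono-at v = travel mono-stable (conn* z₀ v) (st₀ , all-j)

    colour-j : ∀ {v c} → MonoState v c → ∀ e → c (other H v e) ≡ j
    colour-j {v} (_ , all) e = all (other H v e) (other-≢ H v e)

    hard : Hard H f
    hard = hardM H f j (conn , λ (w , sep) → walks⇒no-separating H w (walk w) sep) f-j f-≢j
      where
      f-j : ∀ v → f v j ≡ deg H v
      f-j v with mono-at v
      ... | c , ms = trans (f-count (proj₁ ms) j) (count-cong (λ e →
        bool-ext (∧-trueˡ {inc H e v}) (λ h → ∧-true h (dec-true (c (other H v e) ≟ j) (colour-j ms e)))))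
      f-≢j : ∀ v i → i ≢ j → f v i ≡ 0
      f-≢j v i i≢j with mono-at v
      ... | c , ms = trans (f-count (proj₁ ms) i) (trans (sum-cong (λ e → ind-false (λ h →
        i≢j (trans (sym (does⇒ (c (other H v e) ≟ i) (∧-trueʳ {inc H e v} h))) (colour-j ms e))))) (sum-0 {ne H}))

  -- Several colours off the hole: reduction to multigraphs

  module Polychromatic (z₀ : V) (c₀ : V → Fin p) (st₀ : State z₀ c₀)
    (two : ∃[ u ] ∃[ w ] (u ≢ z₀ × w ≢ z₀ × c₀ u ≢ c₀ w)) where

    PolyState : V → (V → Fin p) → Set
    PolyState z c = State z c × ∃[ u ] ∃[ w ] (u ≢ z × w ≢ z × c u ≢ c w)

    -- The colour of the new hole reappears at `z`, so `z` can replace whichever of `u` and `w`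
    -- became the hole.
    poly-stable : Stable PolyState
    poly-stable {z} {c} {x} (st , u , w , u≢z , w≢z , c≢) adj@(z≢x , _) = move st adj , colours (u ≟ x) (w ≟ x)
      where
      c′ = upd c z (c x)
      at-z : c′ z ≡ c x
      at-z = upd-at c z (c x)
      off : ∀ {v} → v ≢ z → c′ v ≡ c v
      off = upd-off c (c x)
      colours : Dec (u ≡ x) → Dec (w ≡ x) → ∃[ u ] ∃[ w ] (u ≢ x × w ≢ x × c′ u ≢ c′ w)
      colours (yes refl) (yes refl) = contradiction refl c≢
      colours (yes refl) (no w≢x) = z , w , z≢x , w≢x , λ eq → c≢ (trans (sym at-z) (trans eq (off w≢z)))
      colours (no u≢x) (yes refl) = u , z , u≢x , z≢x , λ eq → c≢ (trans (sym (off u≢z)) (trans eq at-z))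
      colours (no u≢x) (no w≢x) = u , w , u≢x , w≢x , λ eq → c≢ (trans (sym (off u≢z)) (trans eq (off w≢z)))

    start : ∃ λ z → ∃ (PolyState z)
    start = z₀ , c₀ , st₀ , two

    open Sliding (Adj H) (adj? H) (adj-sym H) proj₁ conn* walk PolyState poly-stable proj₂

    -- By `edge-mono` an edge with three vertices would be a rigid set.
    ordinary : ∀ e → Ordinary H e
    ordinary e with m≤n⇒m<n∨m≡n (inc-≥2 H e)
    ... | inj₂ eq = sym eq
    ... | inj₁ three with count-pos⇒ (inc H e) (≤-trans (s≤s z≤n) (inc-≥2 H e))
    ... | a , ea with count≥2⇒ (inc H e) (inc-≥2 H e) a
    ... | b , eb , b≢a with count≥3⇒ (inc H e) three a b
    ... | d , ed , d≢a , d≢b = ⊥-elim (Rigid.absurd start (λ v → inc H e v ≡ true) (λ v → inc H e v ≟ᵇ true)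
      a b d ea eb ed (b≢a ∘ sym) (d≢a ∘ sym) (d≢b ∘ sym)
      (λ st ez eu ew u≢z w≢z → edge-mono (proj₁ st) e ez _ _ eu ew u≢z w≢z))

    -- The first factor makes the diagonal vanish, as `m-zero` demands; `mult H a a` is the degree
    -- of `a`.
    m : V → V → ℕ
    m a b = count (λ e → not (does (b ≟ a)) ∧ (inc H e a ∧ inc H e b))

    m-mult : ∀ {a b} → a ≢ b → mult H a b ≡ m a b
    m-mult {a} {b} a≢b rewrite dec-false (b ≟ a) (a≢b ∘ sym) = refl

    m-pos : ∀ {a b} → Adj H a b → 1 ≤ m a b
    m-pos {a} {b} (a≢b , e , ea , eb) = ≤-trans (count-pos (λ e → inc H e a ∧ inc H e b) e (∧-true ea eb))
      (≤-reflexive (m-mult a≢b))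

    m-zero : ∀ {a b} → ¬ Adj H a b → m a b ≡ 0
    m-zero {a} {b} h = trans (sum-cong (λ e → ind-false (none e))) (sum-0 {ne H})
      where
      none : ∀ e → not (does (b ≟ a)) ∧ (inc H e a ∧ inc H e b) ≢ true
      none e t with b ≟ a
      ... | no b≢a = h ((b≢a ∘ sym) , e , ∧-trueˡ {inc H e a} t , ∧-trueʳ {inc H e a} t)

    m-sym : ∀ a b → m a b ≡ m b a
    m-sym a b = by-cases (a ≟ b)
      where
      by-cases : Dec (a ≡ b) → m a b ≡ m b a
      by-cases (yes refl) = refl
      by-cases (no a≢b) = trans (sym (m-mult a≢b)) (trans (count-cong (λ e → ∧-comm (inc H e a) (inc H e b))) (m-mult (a≢b ∘ sym)))

    -- The edges at `z` are grouped by their other end, which is unique because all edges are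
    -- ordinary.
    f-sum : ∀ {z c} → PolyState z c → ∀ i → f z i ≡ sumFin (λ u → m z u * ind (does (c u ≟ i)))
    f-sum {z} {c} (st , _) i = begin
      f z i                                                  ≡⟨ f-count st i ⟩
      sumFin (λ e → ind (inc H e z ∧ does (c (other H z e) ≟ i))) ≡⟨ sum-cong per-edge ⟩
      sumFin (λ e → sumFin (λ u → χ u * ind (A u e)))        ≡⟨ sym (sum-swap (λ u e → χ u * ind (A u e))) ⟩
      sumFin (λ u → sumFin (λ e → χ u * ind (A u e)))        ≡⟨ sum-cong (λ u → trans (sum-*ˡ (χ u) (λ e → ind (A u e))) (*-comm (χ u) (m z u))) ⟩
      sumFin (λ u → m z u * χ u)                             ∎
      where
      open ≡-Reasoning
      χ : V → ℕ
      χ u = ind (does (c u ≟ i))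
      A : V → Fin (ne H) → Bool
      A u e = not (does (u ≟ z)) ∧ (inc H e z ∧ inc H e u)
      A-false : ∀ {u e} → ¬ A u e ≡ true → χ u * ind (A u e) ≡ 0
      A-false {u} h = trans (cong (χ u *_) (ind-false h)) (*-zeroʳ (χ u))
      A-elim : ∀ {u e} → A u e ≡ true → u ≢ z × inc H e z ≡ true × inc H e u ≡ true
      A-elim {u} {e} h with u ≟ z
      ... | no u≢z = u≢z , ∧-trueˡ {inc H e z} h , ∧-trueʳ {inc H e z} h
      per-edge : ∀ e → ind (inc H e z ∧ does (c (other H z e) ≟ i)) ≡ sumFin (λ u → χ u * ind (A u e))
      per-edge e = by-cases (inc H e z ≟ᵇ true)
        where
        o = other H z e
        by-cases : Dec (inc H e z ≡ true) → ind (inc H e z ∧ does (c o ≟ i)) ≡ sumFin (λ u → χ u * ind (A u e))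
        by-cases (no ¬ez) = trans (ind-false (λ h → ¬ez (∧-trueˡ {inc H e z} h)))
          (sym (trans (sum-cong (λ u → A-false {u} {e} (λ h → ¬ez (proj₁ (proj₂ (A-elim {u} {e} h)))))) (sum-0 {nv H})))
        by-cases (yes ez) = trans (trans (cong (λ b → ind (b ∧ does (c o ≟ i))) ez) (sym (trans (cong (χ o *_) (ind-true A-o)) (*-identityʳ (χ o)))))
          (sym (sum-single _ o (λ u u≢o → A-false {u} {e} (λ h → only u u≢o (A-elim {u} {e} h)))))
          where
          A-o : A o e ≡ true
          A-o = ∧-true (cong not (dec-false (o ≟ z) (other-≢ H z e))) (∧-true ez (other-∈ H z e))
          only : ∀ u → u ≢ o → ¬ (u ≢ z × inc H e z ≡ true × inc H e u ≡ true)
          only u u≢o (u≢z , _ , eu) = <⇒≱ (count≥3 (inc H e) z u o ez eu (other-∈ H z e) (u≢z ∘ sym) (other-≢ H z e ∘ sym) u≢o)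
            (≤-reflexive (ordinary e))

    open Weighted m m-pos m-zero m-sym f start f-sum

    -- Any two vertices adjacent: case (K)

    module Complete (complete : ∀ u w → u ≢ w → Adj H u w) where

      b : V
      b = proj₁ two
      z₀≢b : z₀ ≢ b
      z₀≢b = proj₁ (proj₂ (proj₂ two)) ∘ sym

      t : ℕ
      t = m z₀ b

      m-z₀ : ∀ w → z₀ ≢ w → m z₀ w ≡ t
      m-z₀ w z₀≢w with w ≟ b
      ... | yes refl = refl
      ... | no w≢b = triangle (complete z₀ w z₀≢w) (complete w b w≢b) (complete b z₀ (z₀≢b ∘ sym))

      -- A triangle through `z₀` reduces each multiplicity to one at `z₀`, and there triangles
      -- through `b` give `t`.
      m-t : ∀ u w → u ≢ w → m u w ≡ t
      m-t u w u≢w with u ≟ z₀ | w ≟ z₀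
      ... | yes refl | _ = m-z₀ w u≢w
      ... | no u≢z | yes refl = trans (m-sym u z₀) (m-z₀ u (u≢z ∘ sym))
      ... | no u≢z | no w≢z = trans (triangle (complete u w u≢w) (complete w z₀ w≢z) (complete z₀ u (u≢z ∘ sym)))
        (trans (m-sym u z₀) (m-z₀ u (u≢z ∘ sym)))

      coloured : V → (V → Fin p) → Fin p → V → Bool
      coloured z c i u = not (does (u ≟ z)) ∧ does (c u ≟ i)

      coloured-at : ∀ z c i → ind (coloured z c i z) ≡ 0
      coloured-at z c i rewrite dec-true (z ≟ z) refl = refl

      coloured-off : ∀ {z c i u} → u ≢ z → coloured z c i u ≡ does (c u ≟ i)
      coloured-off {z} {u = u} u≢z rewrite dec-false (u ≟ z) u≢z = refl

      f-coloured : ∀ {z c} → PolyState z c → ∀ i → f z i ≡ t * count (coloured z c i)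
      f-coloured {z} {c} st i = trans (f-sum st i) (trans (sum-cong pt) (sum-*ˡ t (λ u → ind (coloured z c i u))))
        where
        pt : ∀ u → m z u * ind (does (c u ≟ i)) ≡ t * ind (coloured z c i u)
        pt u = by-cases (u ≟ z)
          where
          by-cases : Dec (u ≡ z) → m z u * ind (does (c u ≟ i)) ≡ t * ind (coloured z c i u)
          by-cases (yes refl) = trans (cong (_* ind (does (c u ≟ i))) (m-zero {z} {z} (λ a → proj₁ a refl)))
            (sym (trans (cong (t *_) (coloured-at z c i)) (*-zeroʳ t)))
          by-cases (no u≢z) = cong₂ _*_ (m-t z u (u≢z ∘ sym)) (cong ind (sym (coloured-off {z} {c} {i} u≢z)))

      ns : Fin p → ℕ
      ns i = count (coloured z₀ c₀ i)

      -- Only `z₀` and `v` matter: the colour leaves `v` and arrives at `z₀`. Hence the numbers `ns`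
      -- serve for all vertices.
      ns-move : ∀ {v} → z₀ ≢ v → ∀ i → count (coloured v (upd c₀ z₀ (c₀ v)) i) ≡ ns i
      ns-move {v} z≢v i = sym (+-cancelʳ-≡ x _ _ (trans (cong (ns i +_) (sym h-sum)) (trans (sum-at₂ g h z₀ v z≢v off) (cong (sumFin h +_) g-sum))))
        where
        c′ = upd c₀ z₀ (c₀ v)
        x = ind (does (c₀ v ≟ i))
        g h : V → ℕ
        g u = ind (coloured z₀ c₀ i u)
        h u = ind (coloured v c′ i u)
        h-sum : h z₀ + h v ≡ x
        h-sum = trans (cong₂ _+_ (cong ind (trans (coloured-off {v} {c′} {i} z≢v) (cong (λ y → does (y ≟ i)) (upd-at c₀ z₀ (c₀ v)))))
          (coloured-at v c′ i)) (+-identityʳ x)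
        g-sum : g z₀ + g v ≡ x
        g-sum = cong₂ _+_ (coloured-at z₀ c₀ i) (cong ind (coloured-off {z₀} {c₀} {i} (z≢v ∘ sym)))
        off : ∀ u → u ≢ z₀ → u ≢ v → g u ≡ h u
        off u u≢z u≢v = cong ind (trans (coloured-off {z₀} {c₀} {i} u≢z) (trans
          (cong (λ y → does (y ≟ i)) (sym (upd-off c₀ (c₀ v) u≢z))) (sym (coloured-off {v} {c′} {i} u≢v))))

      f-ns : ∀ v i → f v i ≡ t * ns i
      f-ns v i with v ≟ z₀
      ... | yes refl = f-coloured (st₀ , two) i
      ... | no v≢z = trans (f-coloured (poly-stable (st₀ , two) (complete z₀ v (v≢z ∘ sym))) i) (cong (t *_) (ns-move (v≢z ∘ sym) i))

      ns-sum : sumFin ns ≡ nv H ∸ 1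
      ns-sum = trans (sum-swap (λ i u → ind (coloured z₀ c₀ i u))) (trans (sum-cong pt)
          (trans (sym (m+n∸n≡m (count (full ∖ z₀)) 1)) (cong (_∸ 1) (trans (sym (count-∖ full z₀)) (sum-1 {nv H})))))
        where
        pt : ∀ u → sumFin (λ i → ind (coloured z₀ c₀ i u)) ≡ ind ((full ∖ z₀) u)
        pt u with does (u ≟ z₀)
        ... | true  = sum-0 {p}
        ... | false = sum-colour (c₀ u)

      ns-≢0 : ∀ {u} → u ≢ z₀ → ns (c₀ u) ≢ 0
      ns-≢0 {u} u≢z eq = <⇒≢ (count-pos (coloured z₀ c₀ (c₀ u)) u
        (trans (coloured-off {z₀} {c₀} u≢z) (dec-true (c₀ u ≟ c₀ u) refl))) (sym eq)

      hard : Hard H f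
      hard = let (u , w , u≢z , w≢z , c≢) = two in hardK H f t (nv H) (m-pos (complete z₀ b z₀≢b))
        (≤-trans (count≥3 full z₀ u w refl refl refl (u≢z ∘ sym) (w≢z ∘ sym) (λ { refl → c≢ refl })) (≤-reflexive sum-1))
        refl ordinary (λ u w u≢w → trans (m-mult u≢w) (m-t u w u≢w))
        ns (c₀ u , c₀ w , c≢ , ns-≢0 u≢z , ns-≢0 w≢z) ns-sum f-ns

    -- A spanning chordless cycle: case (C)

    module Incomplete {k : ℕ} {s : ℕ → V} (k≥4 : 4 ≤ k) (ch : Chordless k s)
      (c : V → Fin p) (st : PolyState (s 0) c) where

      t : ℕ
      t = m (s 0) (s 1)

      pos : V → ℕ
      pos v = proj₁ (cycle-spans k≥4 ch v)

      pos-< : ∀ v → pos v < suc k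
      pos-< v = proj₁ (proj₂ (cycle-spans k≥4 ch v))

      pos-≤ : ∀ v → pos v ≤ k
      pos-≤ v = ≤-pred (pos-< v)

      s-pos : ∀ v → s (pos v) ≡ v
      s-pos v = proj₂ (proj₂ (cycle-spans k≥4 ch v))

      s-injective : ∀ {i j} → i ≤ k → j ≤ k → s i ≡ s j → i ≡ j
      s-injective {i} {j} i≤ j≤ eq with i ≟ℕ j
      ... | yes e = e
      ... | no i≢j = contradiction eq (distinct′ (cycle ch) i≤ j≤ i≢j)

      order : nv H ≡ suc k
      order = ≤-antisym
        (injective⇒≤ {f = λ v → fromℕ< (pos-< v)} (λ {u} {v} eq → trans (sym (s-pos u)) (trans
          (cong s (trans (sym (toℕ-fromℕ< (pos-< u))) (trans (cong toℕ eq) (toℕ-fromℕ< (pos-< v))))) (s-pos v))))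
        (injective⇒≤ {m = suc k} {f = λ i → s (toℕ i)} (λ {i} {j} eq →
          toℕ-injective (s-injective (≤-pred (toℕ<n i)) (≤-pred (toℕ<n j)) eq)))

      pos-<′ : ∀ v → pos v < nv H
      pos-<′ v = subst (pos v <_) (sym order) (pos-< v)

      σ : V ↔ V
      σ = mk↔ₛ′ (λ v → fromℕ< (pos-<′ v)) (λ i → s (toℕ i))
        (λ i → toℕ-injective (trans (toℕ-fromℕ< (pos-<′ (s (toℕ i))))
          (s-injective (pos-≤ _) (≤-pred (subst (toℕ i <_) order (toℕ<n i))) (s-pos (s (toℕ i))))))
        (λ v → trans (cong s (toℕ-fromℕ< (pos-<′ v))) (s-pos v))

      -- Cyclic adjacency for plain positions, which can be matched on; `σ-adj` relates it to
      -- `CycAdj`.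
      CycAdjℕ : ℕ → ℕ → Set
      CycAdjℕ i j = (suc i ≡ j) ⊎ (suc j ≡ i) ⊎ (i ≡ 0 × suc j ≡ nv H) ⊎ (j ≡ 0 × suc i ≡ nv H)

      σ-adj : ∀ u w → CycAdj (Inverse.to σ u) (Inverse.to σ w) ≡ CycAdjℕ (pos u) (pos w)
      σ-adj u w = cong₂ CycAdjℕ (toℕ-fromℕ< (pos-<′ u)) (toℕ-fromℕ< (pos-<′ w))

      m-adjacent : ∀ {i j} → i ≤ k → j ≤ k → CycAdjℕ i j → m (s i) (s j) ≡ t
      m-adjacent i≤ j≤ (inj₁ refl) = weight _ k≥4 ch st j≤
      m-adjacent {suc j} i≤ j≤ (inj₂ (inj₁ refl)) = trans (m-sym (s (suc j)) (s j)) (weight j k≥4 ch st i≤)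
      m-adjacent i≤ j≤ (inj₂ (inj₂ (inj₁ (refl , eq)))) with refl ← suc-injective (trans eq order) =
        trans (m-sym (s 0) (s k)) (weight-close k≥4 ch st)
      m-adjacent i≤ j≤ (inj₂ (inj₂ (inj₂ (refl , eq)))) with refl ← suc-injective (trans eq order) =
        weight-close k≥4 ch st

      nonadjacent-< : ∀ {i j} → i < j → j ≤ k → ¬ CycAdjℕ i j → ¬ Adj H (s i) (s j)
      nonadjacent-< {zero} {j} lt j≤ ¬adj = no-chord₀ ch (≤∧≢⇒< lt (λ eq → ¬adj (inj₁ eq)))
        (≤∧≢⇒< j≤ (λ { refl → ¬adj (inj₂ (inj₂ (inj₁ (refl , sym order)))) }))
      nonadjacent-< {suc i} lt j≤ ¬adj = no-chord ch (s≤s z≤n) (≤∧≢⇒< lt (λ eq → ¬adj (inj₁ eq))) j≤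

      CycAdjℕ-sym : ∀ {i j} → CycAdjℕ i j → CycAdjℕ j i
      CycAdjℕ-sym (inj₁ x) = inj₂ (inj₁ x)
      CycAdjℕ-sym (inj₂ (inj₁ x)) = inj₁ x
      CycAdjℕ-sym (inj₂ (inj₂ (inj₁ x))) = inj₂ (inj₂ (inj₂ x))
      CycAdjℕ-sym (inj₂ (inj₂ (inj₂ x))) = inj₂ (inj₂ (inj₁ x))

      nonadjacent : ∀ {i j} → i ≢ j → i ≤ k → j ≤ k → ¬ CycAdjℕ i j → ¬ Adj H (s i) (s j)
      nonadjacent {i} {j} i≢j i≤ j≤ ¬adj with <-cmp i j
      ... | tri< lt _ _ = nonadjacent-< lt j≤ ¬adj
      ... | tri≈ _ eq _ = contradiction eq i≢j
      ... | tri> _ _ gt = λ a → nonadjacent-< gt i≤ (λ h → ¬adj (CycAdjℕ-sym h)) (adj-sym H a)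

      f-value : ∀ v i → f v i ≡ t * (ind (does (c (s 1) ≟ i)) + ind (does (c (s k) ≟ i)))
      f-value v i = trans (cong (λ v → f v i) (sym (s-pos v))) (f-on-cycle (pos v) k≥4 ch st (pos-≤ v) i)

      differ : c (s 1) ≢ c (s k)
      differ = ends-differ k≥4 ch st

      hard : Hard H f
      hard with even k≥4 ch st
      ... | q , k≡2q = hardC H f t q (m-pos (step (cycle ch) (≤-trans (s≤s z≤n) k≥4)))
        (≤-trans (s≤s k≥4) (≤-reflexive (sym order))) (trans order (cong suc k≡2q)) σ ordinary
        (λ u w u≢w adj → trans (m-mult u≢w) (trans (cong₂ m (sym (s-pos u)) (sym (s-pos w)))
          (m-adjacent (pos-≤ u) (pos-≤ w) (subst id (σ-adj u w) adj))))
        (λ u w u≢w ¬adj → trans (m-mult u≢w) (m-zero (subst₂ (λ x y → ¬ Adj H x y) (s-pos u) (s-pos w)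
          (nonadjacent (λ eq → u≢w (trans (sym (s-pos u)) (trans (cong s eq) (s-pos w)))) (pos-≤ u) (pos-≤ w)
            (λ h → ¬adj (subst id (sym (σ-adj u w)) h))))))
        (c (s 1)) (c (s k)) differ
        (λ v → trans (f-value v (c (s 1))) (trans (cong₂ (λ x y → t * (ind x + ind y)) (dec-true (c (s 1) ≟ _) refl) (dec-false (c (s k) ≟ _) (differ ∘ sym))) (*-identityʳ t)))
        (λ v → trans (f-value v (c (s k))) (trans (cong₂ (λ x y → t * (ind x + ind y)) (dec-false (c (s 1) ≟ _) differ) (dec-true (c (s k) ≟ _) refl)) (*-identityʳ t)))
        (λ v i i≢a i≢b → trans (f-value v i) (trans (cong₂ (λ x y → t * (ind x + ind y))
          (dec-false (c (s 1) ≟ i) (i≢a ∘ sym)) (dec-false (c (s k) ≟ i) (i≢b ∘ sym))) (*-zeroʳ t)))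

    -- If `u` has a non-neighbour, connectivity gives an edge leaving its closed neighbourhood, from
    -- `a` to `b`. Then `a` is not `u`, and `u`, `a`, `b` is an induced path to which `long-cycle`
    -- applies.
    hard : Hard H f
    hard with any? (λ u → any? (λ w → ¬? (u ≟ w) ×-dec ¬? (adj? H u w)))
    ... | no none = Complete.hard (λ u w u≢w → decidable-stable (adj? H u w) (λ u≁w → none (u , w , u≢w , u≁w)))
    ... | yes (u , w , u≢w , u≁w) = found
      where
      ball? : ∀ v → Dec (v ≡ u ⊎ Adj H u v)
      ball? v = (v ≟ u) ⊎-dec adj? H u v
      X : VSet H
      X v = does (ball? v)
      found : Hard H f
      found with proj₂ conn X (u , dec-true (ball? u) (inj₁ refl))
                   (w , dec-false (ball? w) [ (λ eq → u≢w (sym eq)) , u≁w ]′)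
      ... | e , a , b , ea , Xa , eb , Xb with does⇒¬ (ball? b) Xb | does⇒ (ball? a) Xa
      ... | b∉ | inj₁ refl = contradiction (inj₂ ((λ { refl → b∉ (inj₁ refl) }) , e , ea , eb)) b∉
      ... | b∉ | inj₂ ua
        with long-cycle (λ eq → b∉ (inj₁ (sym eq))) (λ ub → b∉ (inj₂ ub)) ua ((λ { refl → b∉ (inj₂ ua) }) , e , ea , eb)
      ... | k , s , k≥4 , ch
        with travel {St = PolyState} (λ {_} {c} → poly-stable {c = c}) (conn* z₀ (s 0)) {c₀} (st₀ , two)
      ... | c , st = Incomplete.hard k≥4 ch c st

  block-hard : Hard H f
  block-hard = by-state (state-exists conn d≤ i₀ z₀)
    where
    z₀ : V
    z₀ = fromℕ< (proj₁ conn)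
    by-state : ∃ (State z₀) → Hard H f
    by-state (c₀ , st₀) with any? (λ u → any? (λ w → ¬? (u ≟ z₀) ×-dec (¬? (w ≟ z₀) ×-dec ¬? (c₀ u ≟ c₀ w))))
    ... | yes two = Polychromatic.hard z₀ c₀ st₀ two
    ... | no none with any? (λ u → ¬? (u ≟ z₀))
    ... | yes (w , w≢z) = Monochromatic.hard (c₀ w) z₀ c₀ st₀
      (λ u u≢z → decidable-stable (c₀ u ≟ c₀ w) (λ c≢ → none (u , w , u≢z , w≢z , c≢)))
    -- `H` has a single vertex, so any colour will do.
    ... | no single = Monochromatic.hard i₀ z₀ c₀ st₀ (λ u u≢z → contradiction (u , u≢z) single)

-- Induction on the number of vertices

separating-or-walks : ∀ H → (∀ w u v → u ≢ w → v ≢ w → Star (Avoid H w) u v) ⊎ ∃ (Separating H)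
separating-or-walks H = all-or λ w → all-or λ u → all-or λ v → at w u v
  where
  at : ∀ w u v → (u ≢ w → v ≢ w → Star (Avoid H w) u v) ⊎ ∃ (Separating H)
  at w u v with u ≟ w | v ≟ w
  ... | yes u≡w | _ = inj₁ λ u≢w _ → contradiction u≡w u≢w
  ... | no _ | yes v≡w = inj₁ λ _ v≢w → contradiction v≡w v≢w
  ... | no u≢w | no v≢w with separating-or-walk H w u v u≢w v≢w
  ... | inj₁ walk = inj₁ λ _ _ → walk
  ... | inj₂ sep = inj₂ (w , sep)

-- The strict bound `k` on the number of vertices is the decreasing argument; the given colour
-- serves as default where nothing has been coloured yet.
hard-by-size : ∀ {p} → Fin p → ∀ k (H : Hypergraph) (f : VFun p H) → nv H < k → Connected H →
  (∀ v → deg H v ≤ sumFin (f v)) → ¬ Partitionable H f → Hard H f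
hard-by-size i₀ (suc k) H f lt conn d≤ np with separating-or-walks H
... | inj₁ walk = Block.block-hard H f conn i₀ d≤ np walk
... | inj₂ sep = merge H f conn i₀ d≤ np sep
  (λ H′ f′ lt′ → hard-by-size i₀ k H′ f′ (<-≤-trans lt′ (≤-pred lt)))

theorem2p5 : (H : Hypergraph) → Connected H → (p : ℕ) → 1 ≤ p →
    (f : VFun p H) → (∀ v → deg H v ≤ sumFin (f v)) →
    ¬ Partitionable H f → Hard H f
theorem2p5 H conn (suc p) _ f = hard-by-size zero (suc (nv H)) H f ≤-refl conn
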